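{- Let $T=(T^{*},T^{\triangle})$ be a spherical latin bitrade and let $a=(a_1,a_2,a_3)\in T^{*}$ be such that the solution of $\operatorname{Eq}(T,a)$ is separated. Then the triangles $\Delta(c,a)$, $c\in T^{\triangle}$, are all nondegenerate and they dissect the triangle $\Sigma=\{(x,y): x\ge 0,\ y\ge 0,\ x+y\le 1\}$, i.e. $\bigcup_{c\in T^{\triangle}}\Delta(c,a)=\Sigma$ and distinct triangles $\Delta(c,a)$, $\Delta(c',a)$ ($c\neq c'$) have no common interior point. Moreover this dissection is separated.
   Context: A latin bitrade is a pair $T=(T^{*},T^{\triangle})$ of finite sets of triples satisfying: (R1) $T^{*}\cap T^{\triangle}=\emptyset$; (R2) for every $p\in T^{*}$ and all $r\neq s$ in $\{1,2,3\}$ there is exactly one $q\in T^{\triangle}$ with $p_r=q_r$ and $p_s=q_s$; (R3) for every $q\in T^{\triangle}$ and all $r\neq s$ in $\{1,2,3\}$ there is exactly one $p\in T^{*}$ with $q_r=p_r$ and $q_s=p_s$. First, second and third coordinates are called rows, columns and symbols; these three sets of labels are assumed pairwise disjoint. $T$ is indecomposable if it is not the disjoint union of two nonempty latin bitrades. The size is $s=|T^{*}|$; $o_i$ is the number of distinct $i$-th coordinates of elements of $T^{*}$, and $m=o_1+o_2+o_3$. $T$ is spherical if it is indecomposable and $m=s+2$. For $a=(a_1,a_2,a_3)\in T^{*}$, $\operatorname{Eq}(T,a)$ is the linear system whose unknowns are the row, column and symbol labels, consisting of the equations $b_1+b_2=b_3$ for all $(b_1,b_2,b_3)\in T^{*}\setminus\{a\}$,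 with the substitutions $a_1=0$, $a_2=0$, $a_3=1$. For spherical $T$ this system has a unique solution in rational numbers; the value assigned to a label $x$ is denoted $\bar x$ (so $\bar a_1=\bar a_2=0$, $\bar a_3=1$). The solution is called separated if for all $b,d\in T^{*}$ and $i\in\{1,2,3\}$: $\bar b_i=\bar d_i$ iff $b_i=d_i$. For $c=(c_1,c_2,c_3)\in T^{\triangle}$ (its coordinates are labels occurring in $T^{*}$), $\Delta(c,a)$ is the closed triangle in $\mathbb{R}^2$ bounded by the lines $y=\bar c_1$, $x=\bar c_2$ and $x+y=\bar c_3$ (the convex hull of their pairwise intersection points); it degenerates if the three lines pass through a common point. A dissection of $\Sigma$ into triangles whose sides lie on horizontal, vertical and slope $-1$ lines is called separated if (i) no point is a vertex of six dissecting triangles, and (ii) for every line $p$ containing a side of a dissecting triangle, the union of all sides of dissecting triangles contained in $p$ is a single contiguous segment.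
   Formalization: The plane is taken over the rationals: the covering of Σ, the absence of common interior points and the separatedness conditions are stated for points with rational coordinates and lines with rational coefficients instead of real ones. -}

module Defs where

open import Data.Nat as ℕ using (ℕ)
open import Data.Fin using (Fin; zero; suc)
open import Data.Rational as ℚ using (ℚ; 0ℚ; 1ℚ; _+_; _-_; _*_; ∣_∣)
open import Data.Product using (_×_; _,_; ∃; ∃-syntax; Σ-syntax)
open import Data.List using (List; []; length; map; deduplicate; _++_)
open import Data.List.Membership.Propositional using (_∈_)
open import Data.List.Relation.Unary.All using (All)
open import Data.List.Relation.Unary.Unique.Propositional using (Unique)
open import Data.List.Relation.Binary.Permutation.Propositional using (_↭_)
open import Relation.Binary.PropositionalEquality using (_≡_; _≢_)
open import Relation.Nullary using (¬_)
open import Data.Empty using (⊥)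
open import Function.Bundles using (_⇔_)

-- Labels are natural numbers; a triple (row, column, symbol).  Rows,
-- columns and symbols are kept apart by their coordinate position: the
-- "label" x in coordinate i is the pair (i , x).
Triple : Set
Triple = ℕ × ℕ × ℕ

coord : Fin 3 → Triple → ℕ
coord zero             (x , y , z) = x
coord (suc zero)       (x , y , z) = y
coord (suc (suc zero)) (x , y , z) = z

ExactlyOneAgreeing : List Triple → Triple → Fin 3 → Fin 3 → Set
ExactlyOneAgreeing Q p r s =
  (∃[ q ] (q ∈ Q × coord r p ≡ coord r q × coord s p ≡ coord s q))
  × (∀ q q′ → q ∈ Q → coord r p ≡ coord r q → coord s p ≡ coord s q
            → q′ ∈ Q → coord r p ≡ coord r q′ → coord s p ≡ coord s q′
            → q ≡ q′)

record IsBitrade (T* T△ : List Triple) : Set where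
  field
    uniq*  : Unique T*
    uniq△  : Unique T△
    R1     : ∀ p → p ∈ T* → ¬ (p ∈ T△)
    R2     : ∀ p → p ∈ T* → ∀ (r s : Fin 3) → r ≢ s → ExactlyOneAgreeing T△ p r s
    R3     : ∀ q → q ∈ T△ → ∀ (r s : Fin 3) → r ≢ s → ExactlyOneAgreeing T* q r s

Decomposable : List Triple → List Triple → Set
Decomposable T* T△ =
  ∃[ A* ] ∃[ A△ ] ∃[ B* ] ∃[ B△ ]
    ( IsBitrade A* A△ × IsBitrade B* B△
    × A* ≢ [] × B* ≢ []
    × T* ↭ A* ++ B* × T△ ↭ A△ ++ B△ )

Indecomposable : List Triple → List Triple → Set
Indecomposable T* T△ = ¬ Decomposable T* T△

size : List Triple → ℕ
size T* = length T*

o : Fin 3 → List Triple → ℕ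
o i T* = length (deduplicate ℕ._≟_ (map (coord i) T*))

m : List Triple → ℕ
m T* = o zero T* ℕ.+ o (suc zero) T* ℕ.+ o (suc (suc zero)) T*

IsSpherical : List Triple → List Triple → Set
IsSpherical T* T△ = IsBitrade T* T△ × Indecomposable T* T△ × m T* ≡ size T* ℕ.+ 2

-- an assignment of rational values to labels; f i x is the value of the
-- label x occurring in coordinate i (rows i=0, columns i=1, symbols i=2)
Assignment : Set
Assignment = Fin 3 → ℕ → ℚ

r₀ c₁ s₂ : Fin 3
r₀ = zero
c₁ = suc zero
s₂ = suc (suc zero)

SolvesEq : List Triple → Triple → Assignment → Set
SolvesEq T* a f =
    (∀ b → b ∈ T* → b ≢ a → f r₀ (coord r₀ b) + f c₁ (coord c₁ b) ≡ f s₂ (coord s₂ b))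
  × f r₀ (coord r₀ a) ≡ 0ℚ
  × f c₁ (coord c₁ a) ≡ 0ℚ
  × f s₂ (coord s₂ a) ≡ 1ℚ

SeparatedSolution : List Triple → Assignment → Set
SeparatedSolution T* f =
  ∀ b d → b ∈ T* → d ∈ T* → ∀ (i : Fin 3) →
    (f i (coord i b) ≡ f i (coord i d)) ⇔ (coord i b ≡ coord i d)

Point : Set
Point = ℚ × ℚ

_⊕_ : Point → Point → Point
(x , y) ⊕ (x′ , y′) = (x + x′ , y + y′)

_·_ : ℚ → Point → Point
t · (x , y) = (t * x , t * y)

OnSegment : Point → Point → Point → Set
OnSegment p₁ p₂ q = ∃[ t ] (0ℚ ℚ.≤ t × t ℚ.≤ 1ℚ × q ≡ ((1ℚ - t) · p₁) ⊕ (t · p₂))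

InHull : Point → Point → Point → Point → Set
InHull p₁ p₂ p₃ q =
  ∃[ l₁ ] ∃[ l₂ ] ∃[ l₃ ]
    ( 0ℚ ℚ.≤ l₁ × 0ℚ ℚ.≤ l₂ × 0ℚ ℚ.≤ l₃ × l₁ + l₂ + l₃ ≡ 1ℚ
    × q ≡ (l₁ · p₁) ⊕ ((l₂ · p₂) ⊕ (l₃ · p₃)) )

IsInteriorPoint : (Point → Set) → Point → Set
IsInteriorPoint S (x , y) =
  ∃[ ε ] (0ℚ ℚ.< ε × (∀ x′ y′ → ∣ x′ - x ∣ ℚ.< ε → ∣ y′ - y ∣ ℚ.< ε → S (x′ , y′)))

InΣ : Point → Set
InΣ (x , y) = 0ℚ ℚ.≤ x × 0ℚ ℚ.≤ y × x + y ℚ.≤ 1ℚ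

-- vertices of Δ(c,a): the pairwise intersections of
-- y = c̄₁ , x = c̄₂ , x + y = c̄₃
module _ (f : Assignment) (c : Triple) where
  private
    c̄₁ c̄₂ c̄₃ : ℚ
    c̄₁ = f r₀ (coord r₀ c)
    c̄₂ = f c₁ (coord c₁ c)
    c̄₃ = f s₂ (coord s₂ c)

  vert₁ : Point
  vert₁ = (c̄₂ , c̄₁)
  vert₂ : Point
  vert₂ = (c̄₂ , c̄₃ - c̄₂)
  vert₃ : Point
  vert₃ = (c̄₃ - c̄₁ , c̄₁)

  InΔ : Point → Set
  InΔ = InHull vert₁ vert₂ vert₃

  Degenerate : Set
  Degenerate = ∃[ x ] ∃[ y ] (y ≡ c̄₁ × x ≡ c̄₂ × x + y ≡ c̄₃)

  IsVertexOfΔ : Point → Set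
  IsVertexOfΔ p = (p ≡ vert₁) Data.Sum.⊎ ((p ≡ vert₂) Data.Sum.⊎ (p ≡ vert₃))
    where import Data.Sum

  OnSideContainedIn : (Point → Set) → Point → Set
  OnSideContainedIn S q =
      ((∀ r → OnSegment vert₁ vert₂ r → S r) × OnSegment vert₁ vert₂ q)
    Data.Sum.⊎ (((∀ r → OnSegment vert₂ vert₃ r → S r) × OnSegment vert₂ vert₃ q)
    Data.Sum.⊎ ((∀ r → OnSegment vert₁ vert₃ r → S r) × OnSegment vert₁ vert₃ q))
    where import Data.Sum

record Line : Set where
  field
    α β κ : ℚ
    nonzero : ¬ (α ≡ 0ℚ × β ≡ 0ℚ)

OnLine : Line → Point → Set
OnLine L (x , y) = Line.α L * x + Line.β L * y ≡ Line.κ L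

CoversΣ : List Triple → Assignment → Set
CoversΣ T△ f = ∀ p → InΣ p ⇔ (∃[ c ] (c ∈ T△ × InΔ f c p))

InteriorsDisjoint : List Triple → Assignment → Set
InteriorsDisjoint T△ f =
  ∀ c c′ → c ∈ T△ → c′ ∈ T△ → c ≢ c′ → ∀ p →
    ¬ (IsInteriorPoint (InΔ f c) p × IsInteriorPoint (InΔ f c′) p)

NoSixfoldVertex : List Triple → Assignment → Set
NoSixfoldVertex T△ f =
  ∀ p (L : List Triple) → Unique L → length L ≡ 6 → All (_∈ T△) L →
    All (λ c → IsVertexOfΔ f c p) L → ⊥

SidesOn : List Triple → Assignment → Line → Point → Set
SidesOn T△ f L q = ∃[ c ] (c ∈ T△ × OnSideContainedIn f c (OnLine L) q)

-- (ii) for every line containing a side, the union of the sides contained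
-- in it is a single contiguous segment (i.e. a (nonempty) convex subset of the line)
ContiguousSides : List Triple → Assignment → Set
ContiguousSides T△ f =
  ∀ (L : Line) → ∀ q₁ q₂ → SidesOn T△ f L q₁ → SidesOn T△ f L q₂ →
    ∀ q → OnSegment q₁ q₂ q → SidesOn T△ f L q

SeparatedDissection : List Triple → Assignment → Set
SeparatedDissection T△ f = NoSixfoldVertex T△ f × ContiguousSides T△ f

{-# OPTIONS --safe #-}
module Submission where

-- Let x, y, z be the indicators of the point p lying beyond the column, row and symbol line of a triple.
-- Then p is inside the triangle iff xy(1-z) + (1-x)(1-y)z = xy + z - xz - yz is 1.  The right-hand side
-- only involves pairs of coordinates, so summing it over T△ or over T* gives the same number.  In T* every
-- triple but a is a triangle of size zero, hence each p (perturbed infinitesimally off all lines) lies in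
-- as many triangles of T△ as it lies in copies of Σ: one or none.
--
-- Each of the three vertices of a triangle determines it by separation, so at most three triangles meet
-- at a point.  For contiguity, count the left ends of the maximal runs of sides on the lines: there is at
-- most one for each triple of T* other than a, and three for a, so at most s + 2 = m in total, while each of
-- the m labels has a leftmost one.  So every label has a single run.

open import Defs
open import Data.Bool using (Bool; true; false; not; _∧_; if_then_else_)
open import Data.Empty using (⊥; ⊥-elim)
open import Data.Fin using (Fin; zero; suc)
open import Data.Fin.Properties as Fin using (pigeonhole)
open import Data.List using (List; []; _∷_; _++_; length; map; deduplicate; concatMap; filter; lookup)
open import Data.List.Properties using (length-map; length-++; map-∘)
open import Data.List.Membership.Propositional using (_∈_; find; lose)
open import Data.List.Membership.Propositional.Properties using (∈-∃++; ∈-map⁺; ∈-map⁻; ∈-++⁺ˡ; ∈-++⁺ʳ; ∈-++⁻; ∈-concatMap⁺; ∈-filter⁺; ∈-filter⁻; ∈-deduplicate⁻; ∈-lookup)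
open import Data.List.Membership.Propositional.Properties.WithK using (unique∧set⇒bag)
open import Data.List.Relation.Binary.BagAndSetEquality using (∼bag⇒↭)
open import Data.List.Relation.Binary.Permutation.Propositional using (_↭_)
open import Data.List.Relation.Binary.Permutation.Propositional.Properties using (shift; ∈-resp-↭; ↭-length; map⁺)
open import Data.List.Relation.Unary.All as All using ([]; _∷_)
import Data.List.Relation.Unary.All.Properties as All
open import Data.List.Relation.Unary.AllPairs using ([]; _∷_)
open import Data.List.Relation.Unary.Any using (here; there; any?)
open import Data.List.Relation.Unary.Unique.Propositional using (Unique)
import Data.List.Relation.Unary.Unique.Propositional.Properties as Unique
open import Data.Nat as ℕ using (ℕ; zero; suc; z≤n; s≤s)
import Data.Nat.Properties as ℕ
open import Data.Nat.Solver renaming (module +-*-Solver to ℕ-Solver)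
open import Data.Nat.ListAction using (sum)
open import Data.Nat.ListAction.Properties using (sum-↭)
open import Data.Product using (_×_; _,_; ∃-syntax; proj₁; proj₂)
import Data.Product.Properties as Product
open import Data.Rational as ℚ using (ℚ; 0ℚ; 1ℚ; _+_; _-_; _*_; -_; ∣_∣; _≤_; _<_)
import Data.Rational.Properties as ℚ
open import Algebra.Properties.Group ℚ.+-0-group using () renaming (∙-cancelˡ to +-cancelˡ; ∙-cancelʳ to +-cancelʳ)
open import Data.Rational.Solver using (module +-*-Solver)
open import Data.Sum using (_⊎_; inj₁; inj₂; [_,_]′; swap)
open import Data.Unit using (⊤; tt)
open import Function using (_∘_; case_of_)
open import Function.Bundles using (mk⇔; Equivalence)
open import Relation.Binary.Definitions using (tri<; tri≈; tri>)
open import Relation.Binary.PropositionalEquality using (_≡_; _≢_; refl; sym; trans; cong; cong₂; subst; subst₂; module ≡-Reasoning)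
open import Relation.Nullary using (¬_; Dec; yes; no; does; contradiction)
open import Relation.Nullary.Decidable using (dec-true; dec-false; _×-dec_; _⊎-dec_)
open import Relation.Binary.Bundles using (DecTotalOrder)
open import Data.List.Extrema (DecTotalOrder.totalOrder ℚ.≤-decTotalOrder) using (argmin; argmin-all; f[argmin]≤f[xs])
open import Data.List.Relation.Unary.Unique.DecPropositional.Properties ℕ._≟_ using (deduplicate-!)

-- Finite lists

module _ {A : Set} where

  ∈⇒↭∷ : {x : A} {xs : List A} → x ∈ xs → ∃[ ys ] xs ↭ x ∷ ys
  ∈⇒↭∷ x∈xs with ys , zs , refl ← ∈-∃++ x∈xs = ys ++ zs , shift _ ys zs

  unique⊆⇒length≤ : {xs ys : List A} → Unique xs → (∀ {x} → x ∈ xs → x ∈ ys) →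
                    length xs ℕ.≤ length ys
  unique⊆⇒length≤ [] _ = z≤n
  unique⊆⇒length≤ {x ∷ xs} {ys} (x∉xs ∷ u) xs⊆ys with zs , ys↭ ← ∈⇒↭∷ (xs⊆ys (here refl)) =
    subst (suc (length xs) ℕ.≤_) (sym (↭-length ys↭)) (s≤s (unique⊆⇒length≤ u xs⊆zs))
    where
    xs⊆zs : ∀ {z} → z ∈ xs → z ∈ zs
    xs⊆zs z∈xs with ∈-resp-↭ ys↭ (xs⊆ys (there z∈xs))
    ... | here refl  = contradiction refl (All.lookup x∉xs z∈xs)
    ... | there z∈zs = z∈zs

  lookup-injective : {xs : List A} → Unique xs → ∀ {i j} → lookup xs i ≡ lookup xs j → i ≡ j
  lookup-injective (_ ∷ _) {zero} {zero} _ = refl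
  lookup-injective {_ ∷ xs} (x∉xs ∷ _) {zero} {suc j} eq =
    contradiction eq (All.lookup x∉xs (∈-lookup j))
  lookup-injective {_ ∷ xs} (x∉xs ∷ _) {suc i} {zero} eq =
    contradiction (sym eq) (All.lookup x∉xs (∈-lookup i))
  lookup-injective (_ ∷ u) {suc i} {suc j} eq = cong suc (lookup-injective u eq)

  sum-map-↭ : (g : A → ℕ) {xs ys : List A} → xs ↭ ys → sum (map g xs) ≡ sum (map g ys)
  sum-map-↭ g xs↭ys = sum-↭ (map⁺ g xs↭ys)

  ≤sum : (g : A → ℕ) {x : A} {xs : List A} → x ∈ xs → g x ℕ.≤ sum (map g xs)
  ≤sum g x∈xs with ys , xs↭ ← ∈⇒↭∷ x∈xs =
    subst (_ ℕ.≤_) (sym (sum-map-↭ g xs↭)) (ℕ.m≤m+n _ _)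

  +≤sum : (g : A → ℕ) {x y : A} {xs : List A} → x ∈ xs → y ∈ xs → x ≢ y →
          g x ℕ.+ g y ℕ.≤ sum (map g xs)
  +≤sum g x∈xs y∈xs x≢y with ys , xs↭ ← ∈⇒↭∷ x∈xs =
    subst (_ ℕ.≤_) (sym (sum-map-↭ g xs↭))
      (ℕ.+-monoʳ-≤ _ (≤sum g (case ∈-resp-↭ xs↭ y∈xs of λ where
        (here y≡x)   → contradiction (sym y≡x) x≢y
        (there y∈ys) → y∈ys)))

  sum>0⇒∃ : (g : A → ℕ) (xs : List A) → 1 ℕ.≤ sum (map g xs) → ∃[ x ] (x ∈ xs × 1 ℕ.≤ g x)
  sum>0⇒∃ g (x ∷ xs) 1≤sum with g x in eq
  ... | suc _ = x , here refl , subst (1 ℕ.≤_) (sym eq) (s≤s z≤n)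
  ... | zero with y , y∈xs , 1≤gy ← sum>0⇒∃ g xs 1≤sum = y , there y∈xs , 1≤gy

  sum≤ : (g : A → ℕ) (k : ℕ) (xs : List A) → (∀ {x} → x ∈ xs → g x ℕ.≤ k) →
         sum (map g xs) ℕ.≤ length xs ℕ.* k
  sum≤ g k []       _   = z≤n
  sum≤ g k (x ∷ xs) g≤k = ℕ.+-mono-≤ (g≤k (here refl)) (sum≤ g k xs (g≤k ∘ there))

  -- Adding `k` on the left avoids a subtraction: every entry but `a` contributes at most `k`. Used
  -- with `k` = 0 for hits and with `k` = 1 for left ends.
  sum≤-except : (g : A → ℕ) (k : ℕ) {a : A} {xs : List A} → Unique xs → a ∈ xs →
                (∀ {x} → x ∈ xs → x ≢ a → g x ℕ.≤ k) →
                sum (map g xs) ℕ.+ k ℕ.≤ g a ℕ.+ length xs ℕ.* k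
  sum≤-except g k {xs = x ∷ xs} (x∉xs ∷ _) (here refl) g≤k = begin
    g x ℕ.+ sum (map g xs) ℕ.+ k     ≤⟨ ℕ.+-monoˡ-≤ k (ℕ.+-monoʳ-≤ (g x) (sum≤ g k xs g≤k′)) ⟩
    g x ℕ.+ length xs ℕ.* k ℕ.+ k    ≡⟨ ℕ.+-assoc (g x) _ k ⟩
    g x ℕ.+ (length xs ℕ.* k ℕ.+ k)  ≡⟨ cong (g x ℕ.+_) (ℕ.+-comm _ k) ⟩
    g x ℕ.+ (k ℕ.+ length xs ℕ.* k)  ∎
    where
    open ℕ.≤-Reasoning
    g≤k′ : ∀ {y} → y ∈ xs → g y ℕ.≤ k
    g≤k′ y∈xs = g≤k (there y∈xs) (All.lookup x∉xs y∈xs ∘ sym)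
  sum≤-except g k {a} {x ∷ xs} (x∉xs ∷ u) (there a∈xs) g≤k = begin
    g x ℕ.+ sum (map g xs) ℕ.+ k     ≡⟨ ℕ.+-assoc (g x) _ k ⟩
    g x ℕ.+ (sum (map g xs) ℕ.+ k)   ≤⟨ ℕ.+-mono-≤ (g≤k (here refl) (All.lookup x∉xs a∈xs))
                                          (sum≤-except g k u a∈xs (g≤k ∘ there)) ⟩
    k ℕ.+ (g a ℕ.+ length xs ℕ.* k)  ≡⟨ ℕ.+-assoc k (g a) _ ⟨
    k ℕ.+ g a ℕ.+ length xs ℕ.* k    ≡⟨ cong (ℕ._+ length xs ℕ.* k) (ℕ.+-comm k (g a)) ⟩
    g a ℕ.+ k ℕ.+ length xs ℕ.* k    ≡⟨ ℕ.+-assoc (g a) k _ ⟩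
    g a ℕ.+ (k ℕ.+ length xs ℕ.* k)  ∎
    where open ℕ.≤-Reasoning

module _ {A B : Set} where

  unique-map : (g : A → B) {xs : List A} → (∀ {x y} → x ∈ xs → y ∈ xs → g x ≡ g y → x ≡ y) →
               Unique xs → Unique (map g xs)
  unique-map g inj []         = []
  unique-map g inj (x∉xs ∷ u) =
    All.map⁺ (All.tabulate λ y∈xs gx≡gy →
      All.lookup x∉xs y∈xs (inj (here refl) (there y∈xs) gx≡gy))
    ∷ unique-map g (λ x∈ y∈ → inj (there x∈) (there y∈)) u

  -- If distinct `x` and `x′` had one image, `x` could be dropped and the images would still exhaust
  -- `ys`, which is duplicate-free and longer than what is left.
  surjective⇒injective : (g : A → B) {xs : List A} {ys : List B} → Unique ys →
                         (∀ {y} → y ∈ ys → y ∈ map g xs) → length xs ℕ.≤ length ys →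
                         ∀ {x x′} → x ∈ xs → x′ ∈ xs → g x ≡ g x′ → x ≡ x′
  surjective⇒injective g {xs} {ys} u sur xs≤ys {x} {x′} x∈xs x′∈xs gx≡gx′
    with zs , xs↭ ← ∈⇒↭∷ x∈xs
    with ∈-resp-↭ xs↭ x′∈xs
  ... | here x′≡x   = sym x′≡x
  ... | there x′∈zs = contradiction ys≤zs (ℕ.<⇒≱ zs<ys)
    where
    ys⊆ : ∀ {y} → y ∈ ys → y ∈ map g zs
    ys⊆ y∈ys with w , w∈xs , refl ← ∈-map⁻ g (sur y∈ys) | ∈-resp-↭ xs↭ w∈xs
    ... | here refl  = subst (_∈ map g zs) (sym gx≡gx′) (∈-map⁺ g x′∈zs)
    ... | there w∈zs = ∈-map⁺ g w∈zs
    ys≤zs : length ys ℕ.≤ length zs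
    ys≤zs = subst (length ys ℕ.≤_) (length-map g zs) (unique⊆⇒length≤ u ys⊆)
    zs<ys : length zs ℕ.< length ys
    zs<ys = subst (ℕ._≤ length ys) (↭-length xs↭) xs≤ys

  length-concatMap : (g : A → List B) (xs : List A) →
                     length (concatMap g xs) ≡ sum (map (length ∘ g) xs)
  length-concatMap g []       = refl
  length-concatMap g (x ∷ xs) =
    trans (length-++ (g x)) (cong (length (g x) ℕ.+_) (length-concatMap g xs))

-- Bitrades

Agree : Fin 3 → Fin 3 → Triple → Triple → Set
Agree r s p q = coord r p ≡ coord r q × coord s p ≡ coord s q

Partners : List Triple → List Triple → Fin 3 → Fin 3 → Set
Partners P Q r s = ∀ p → p ∈ P → ExactlyOneAgreeing Q p r s

coords : Fin 3 → Fin 3 → Triple → ℕ × ℕ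
coords r s t = coord r t , coord s t

module _ (r s : Fin 3) {P Q : List Triple} (P→Q : Partners P Q r s) where

  -- The partner of `p` in `Q` agrees with `p′` too, and its own partner in `P` is unique.
  agree⇒≡ : Partners Q P r s → ∀ {p p′} → p ∈ P → p′ ∈ P → Agree r s p p′ → p ≡ p′
  agree⇒≡ Q→P {p} {p′} p∈P p′∈P (rr , ss) with (q , q∈Q , r≡ , s≡) , _ ← P→Q p p∈P =
    proj₂ (Q→P q q∈Q) p p′ p∈P (sym r≡) (sym s≡) p′∈P (trans (sym r≡) rr) (trans (sym s≡) ss)

  unique-coords : Partners Q P r s → Unique P → Unique (map (coords r s) P)
  unique-coords Q→P = unique-map (coords r s) λ p∈P p′∈P eq →
    agree⇒≡ Q→P p∈P p′∈P (cong proj₁ eq , cong proj₂ eq)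

  coords-⊆ : ∀ {k} → k ∈ map (coords r s) P → k ∈ map (coords r s) Q
  coords-⊆ k∈ with p , p∈P , refl ← ∈-map⁻ (coords r s) k∈
              with (q , q∈Q , r≡ , s≡) , _ ← P→Q p p∈P =
    subst (_∈ map (coords r s) Q) (cong₂ _,_ (sym r≡) (sym s≡)) (∈-map⁺ (coords r s) q∈Q)

-- Each coordinate pair on one side occurs on the other, and none occurs twice, so the two lists of
-- pairs are permutations of each other.
sum-coords : ∀ r s {P Q} → Partners P Q r s → Partners Q P r s → Unique P → Unique Q →
             (g : ℕ × ℕ → ℕ) → sum (map (g ∘ coords r s) P) ≡ sum (map (g ∘ coords r s) Q)
sum-coords r s {P} {Q} P→Q Q→P uP uQ g = begin
  sum (map (g ∘ coords r s) P)     ≡⟨ cong sum (map-∘ P) ⟩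
  sum (map g (map (coords r s) P)) ≡⟨ sum-map-↭ g perm ⟩
  sum (map g (map (coords r s) Q)) ≡⟨ cong sum (map-∘ Q) ⟨
  sum (map (g ∘ coords r s) Q)     ∎
  where
  open ≡-Reasoning
  perm : map (coords r s) P ↭ map (coords r s) Q
  perm = ∼bag⇒↭ (unique∧set⇒bag (unique-coords r s P→Q Q→P uP) (unique-coords r s Q→P P→Q uQ)
           (mk⇔ (coords-⊆ r s P→Q) (coords-⊆ r s Q→P)))

-- Ordered-field facts

-- Reduces an inequality to a known one by an identity between the two differences, which is a
-- matter of ring arithmetic.
≤-shift : ∀ {p q s t} → t - s ≡ q - p → s ≤ t → p ≤ q
≤-shift {p} {q} {s} {t} eq s≤t = subst₂ _≤_
  (solve 2 (λ p s → s :+ (p :- s) := p) refl p s)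
  (trans (solve 3 (λ p s t → t :+ (p :- s) := (t :- s) :+ p) refl p s t)
    (trans (cong (_+ p) eq) (solve 2 (λ p q → (q :- p) :+ p := q) refl p q)))
  (ℚ.+-monoˡ-≤ (p - s) s≤t)
  where open +-*-Solver

<-shift : ∀ {p q s t} → t - s ≡ q - p → s < t → p < q
<-shift {p} {q} {s} {t} eq s<t = subst₂ _<_
  (solve 2 (λ p s → s :+ (p :- s) := p) refl p s)
  (trans (solve 3 (λ p s t → t :+ (p :- s) := (t :- s) :+ p) refl p s t)
    (trans (cong (_+ p) eq) (solve 2 (λ p q → (q :- p) :+ p := q) refl p q)))
  (ℚ.+-monoˡ-< (p - s) s<t)
  where open +-*-Solver

<⇒≱ : ∀ {p q} → p < q → ¬ (q ≤ p)
<⇒≱ p<q q≤p = ℚ.<-irrefl refl (ℚ.<-≤-trans p<q q≤p)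

≤⇒≯ : ∀ {p q} → p ≤ q → ¬ (q < p)
≤⇒≯ p≤q q<p = <⇒≱ q<p p≤q

≤∧≢⇒< : ∀ {p q} → p ≤ q → p ≢ q → p < q
≤∧≢⇒< p≤q p≢q = ℚ.≰⇒> λ q≤p → p≢q (ℚ.≤-antisym p≤q q≤p)

p-0≡p : ∀ p → p - 0ℚ ≡ p
p-0≡p p = ℚ.+-identityʳ p

p≤q⇒0≤q-p : ∀ {p q} → p ≤ q → 0ℚ ≤ q - p
p≤q⇒0≤q-p {p} {q} = ≤-shift (sym (p-0≡p (q - p)))

0≤q-p⇒p≤q : ∀ {p q} → 0ℚ ≤ q - p → p ≤ q
0≤q-p⇒p≤q {p} {q} = ≤-shift (p-0≡p (q - p))

q-p≤0⇒q≤p : ∀ {p q} → q - p ≤ 0ℚ → q ≤ p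
q-p≤0⇒q≤p {p} {q} = ≤-shift (solve 2 (λ p q → con 0ℚ :- (q :- p) := p :- q) refl p q)
  where open +-*-Solver

q≤p⇒q-p≤0 : ∀ {p q} → q ≤ p → q - p ≤ 0ℚ
q≤p⇒q-p≤0 {p} {q} = ≤-shift (solve 2 (λ p q → p :- q := con 0ℚ :- (q :- p)) refl p q)
  where open +-*-Solver

p<q⇒0<q-p : ∀ {p q} → p < q → 0ℚ < q - p
p<q⇒0<q-p {p} {q} = <-shift (sym (p-0≡p (q - p)))

0≤*0≤ : ∀ {p q} → 0ℚ ≤ p → 0ℚ ≤ q → 0ℚ ≤ p * q
0≤*0≤ {p} {q} 0≤p 0≤q =
  ℚ.nonNegative⁻¹ (p * q) {{ℚ.nonNeg*nonNeg⇒nonNeg p {{ℚ.nonNegative 0≤p}} q {{ℚ.nonNegative 0≤q}}}}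

0≤*≤0 : ∀ {p q} → 0ℚ ≤ p → q ≤ 0ℚ → p * q ≤ 0ℚ
0≤*≤0 {p} {q} 0≤p q≤0 =
  ℚ.nonPositive⁻¹ (p * q) {{ℚ.nonNeg*nonPos⇒nonPos p {{ℚ.nonNegative 0≤p}} q {{ℚ.nonPositive q≤0}}}}

≤0*≤0 : ∀ {p q} → p ≤ 0ℚ → q ≤ 0ℚ → 0ℚ ≤ p * q
≤0*≤0 {p} {q} p≤0 q≤0 =
  ℚ.nonNegative⁻¹ (p * q) {{ℚ.nonPos*nonPos⇒nonPos p {{ℚ.nonPositive p≤0}} q {{ℚ.nonPositive q≤0}}}}

inverse⁺ : ∀ {p} → 0ℚ < p → ∃[ μ ] (0ℚ ≤ μ × μ * p ≡ 1ℚ)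
inverse⁺ {p} 0<p =
  ℚ.1/ p , ℚ.<⇒≤ (ℚ.positive⁻¹ (ℚ.1/ p) {{ℚ.1/pos⇒pos p}}) , ℚ.*-inverseˡ p
  where instance
    _ = ℚ.positive 0<p
    _ = ℚ.pos⇒nonZero p

inverse⁻ : ∀ {p} → p < 0ℚ → ∃[ μ ] (μ ≤ 0ℚ × μ * p ≡ 1ℚ)
inverse⁻ {p} p<0 =
  ℚ.1/ p , ℚ.<⇒≤ (ℚ.negative⁻¹ (ℚ.1/ p) {{ℚ.1/neg⇒neg p}}) , ℚ.*-inverseˡ p
  where instance
    _ = ℚ.negative p<0
    _ = ℚ.neg⇒nonZero p

p*q≡0⇒p≡0 : ∀ {p q} → q ≢ 0ℚ → p * q ≡ 0ℚ → p ≡ 0ℚ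
p*q≡0⇒p≡0 {p} {q} q≢0 pq≡0 = begin
  p                ≡⟨ ℚ.*-identityʳ p ⟨
  p * 1ℚ           ≡⟨ cong (p *_) (ℚ.*-inverseʳ q) ⟨
  p * (q * ℚ.1/ q) ≡⟨ ℚ.*-assoc p q (ℚ.1/ q) ⟨
  p * q * ℚ.1/ q   ≡⟨ cong (_* ℚ.1/ q) pq≡0 ⟩
  0ℚ * ℚ.1/ q      ≡⟨ ℚ.*-zeroˡ (ℚ.1/ q) ⟩
  0ℚ               ∎
  where
  open ≡-Reasoning
  instance _ = ℚ.≢-nonZero q≢0

p-q≡0⇒p≡q : ∀ {p q} → p - q ≡ 0ℚ → p ≡ q
p-q≡0⇒p≡q {p} {q} eq = begin
  p           ≡⟨ solve 2 (λ p q → p := (p :- q) :+ q) refl p q ⟩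
  (p - q) + q ≡⟨ cong (_+ q) eq ⟩
  0ℚ + q      ≡⟨ ℚ.+-identityˡ q ⟩
  q           ∎
  where
  open ≡-Reasoning
  open +-*-Solver

p≡q⇒p-q≡0 : ∀ {p q} → p ≡ q → p - q ≡ 0ℚ
p≡q⇒p-q≡0 {p} refl = ℚ.+-inverseʳ p

-- Triangles

-- The triangle bounded by y = r, x = c, x + y = s points up or down according
-- to the sign of its size.
size△ : ℚ → ℚ → ℚ → ℚ
size△ r c s = s - (r + c)

module _ {r c s x y : ℚ} where
  open +-*-Solver

  Hull : Set
  Hull = InHull (c , r) (c , s - c) (s - r , r) (x , y)

  -- Each of the three linear forms vanishes on one side and equals `size△ r c s` at the opposite
  -- vertex, so at a convex combination it is the weight of that vertex times the size.
  Barycentric : ℚ → ℚ → ℚ → Set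
  Barycentric l₁ l₂ l₃ = s - (x + y) ≡ l₁ * size△ r c s × y - r ≡ l₂ * size△ r c s × x - c ≡ l₃ * size△ r c s

  hull⇒barycentric : Hull → ∃[ l₁ ] ∃[ l₂ ] ∃[ l₃ ] (0ℚ ≤ l₁ × 0ℚ ≤ l₂ × 0ℚ ≤ l₃ × Barycentric l₁ l₂ l₃)
  hull⇒barycentric (l₁ , l₂ , l₃ , 0≤l₁ , 0≤l₂ , 0≤l₃ , Σl≡1 , refl) =
    l₁ , l₂ , l₃ , 0≤l₁ , 0≤l₂ , 0≤l₃ ,
    -- Multiplying `s`, `r` and `c` by the sum of the weights makes each equation a polynomial
    -- identity.
    trans (cong (_- (X + Y)) (1* s))
      (solve 6 (λ r c s l₁ l₂ l₃ →
         (l₁ :+ l₂ :+ l₃) :* s :- ((l₁ :* c :+ (l₂ :* c :+ l₃ :* (s :- r))) :+ (l₁ :* r :+ (l₂ :* (s :- c) :+ l₃ :* r)))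
           := l₁ :* (s :- (r :+ c))) refl r c s l₁ l₂ l₃) ,
    trans (cong (λ z → Y - z) (1* r))
      (solve 6 (λ r c s l₁ l₂ l₃ →
         (l₁ :* r :+ (l₂ :* (s :- c) :+ l₃ :* r)) :- (l₁ :+ l₂ :+ l₃) :* r
           := l₂ :* (s :- (r :+ c))) refl r c s l₁ l₂ l₃) ,
    trans (cong (λ z → X - z) (1* c))
      (solve 6 (λ r c s l₁ l₂ l₃ →
         (l₁ :* c :+ (l₂ :* c :+ l₃ :* (s :- r))) :- (l₁ :+ l₂ :+ l₃) :* c
           := l₃ :* (s :- (r :+ c))) refl r c s l₁ l₂ l₃)
    where
    X Y : ℚ
    X = l₁ * c + (l₂ * c + l₃ * (s - r))
    Y = l₁ * r + (l₂ * (s - c) + l₃ * r)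
    1* : ∀ p → p ≡ (l₁ + l₂ + l₃) * p
    1* p = sym (trans (cong (_* p) Σl≡1) (ℚ.*-identityˡ p))

  -- `μ` is the inverse of the size and may have either sign, so that triangles pointing up and down
  -- share one computation.
  barycentric⇒hull : ∀ μ → μ * size△ r c s ≡ 1ℚ → 0ℚ ≤ (s - (x + y)) * μ → 0ℚ ≤ (y - r) * μ → 0ℚ ≤ (x - c) * μ → Hull
  barycentric⇒hull μ μλ≡1 0≤l₁ 0≤l₂ 0≤l₃ =
    _ , _ , _ , 0≤l₁ , 0≤l₂ , 0≤l₃ ,
    trans (solve 6 (λ r c s x y μ →
             (s :- (x :+ y)) :* μ :+ (y :- r) :* μ :+ (x :- c) :* μ := μ :* (s :- (r :+ c)))
             refl r c s x y μ) μλ≡1 ,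
    cong₂ _,_
      (trans (split x c) (solve 6 (λ r c s x y μ →
          c :* (μ :* (s :- (r :+ c))) :+ (x :- c) :* (μ :* (s :- (r :+ c))) :=
          (s :- (x :+ y)) :* μ :* c :+ ((y :- r) :* μ :* c :+ (x :- c) :* μ :* (s :- r)))
          refl r c s x y μ))
      (trans (split y r) (solve 6 (λ r c s x y μ →
          r :* (μ :* (s :- (r :+ c))) :+ (y :- r) :* (μ :* (s :- (r :+ c))) :=
          (s :- (x :+ y)) :* μ :* r :+ ((y :- r) :* μ :* (s :- c) :+ (x :- c) :* μ :* r))
          refl r c s x y μ))
    where
    -- The factor `μ * size△ r c s`, equal to 1, is inserted to turn the coordinate equations into
    -- polynomial identities.
    split : ∀ p q → p ≡ q * (μ * size△ r c s) + (p - q) * (μ * size△ r c s)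
    split p q rewrite μλ≡1 = solve 2 (λ p q → p := q :* con 1ℚ :+ (p :- q) :* con 1ℚ) refl p q

  hull⇒up : 0ℚ < size△ r c s → Hull → c ≤ x × r ≤ y × x + y ≤ s
  hull⇒up 0<λ h with l₁ , l₂ , l₃ , 0≤l₁ , 0≤l₂ , 0≤l₃ , e₁ , e₂ , e₃ ← hull⇒barycentric h =
    side 0≤l₃ e₃ , side 0≤l₂ e₂ , side 0≤l₁ e₁
    where
    side : ∀ {l p q} → 0ℚ ≤ l → q - p ≡ l * size△ r c s → p ≤ q
    side 0≤l e = 0≤q-p⇒p≤q (subst (0ℚ ≤_) (sym e) (0≤*0≤ 0≤l (ℚ.<⇒≤ 0<λ)))

  hull⇒down : size△ r c s < 0ℚ → Hull → x ≤ c × y ≤ r × s ≤ x + y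
  hull⇒down λ<0 h with l₁ , l₂ , l₃ , 0≤l₁ , 0≤l₂ , 0≤l₃ , e₁ , e₂ , e₃ ← hull⇒barycentric h =
    side 0≤l₃ e₃ , side 0≤l₂ e₂ , side 0≤l₁ e₁
    where
    side : ∀ {l p q} → 0ℚ ≤ l → q - p ≡ l * size△ r c s → q ≤ p
    side 0≤l e = q-p≤0⇒q≤p (subst (_≤ 0ℚ) (sym e) (0≤*≤0 0≤l (ℚ.<⇒≤ λ<0)))

  up⇒hull : 0ℚ < size△ r c s → c ≤ x → r ≤ y → x + y ≤ s → Hull
  up⇒hull 0<λ c≤x r≤y x+y≤s with μ , 0≤μ , μλ≡1 ← inverse⁺ 0<λ =
    barycentric⇒hull μ μλ≡1 (side x+y≤s) (side r≤y) (side c≤x)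
    where
    side : ∀ {p q} → p ≤ q → 0ℚ ≤ (q - p) * μ
    side p≤q = 0≤*0≤ (p≤q⇒0≤q-p p≤q) 0≤μ

  down⇒hull : size△ r c s < 0ℚ → x ≤ c → y ≤ r → s ≤ x + y → Hull
  down⇒hull λ<0 x≤c y≤r s≤x+y with μ , μ≤0 , μλ≡1 ← inverse⁻ λ<0 =
    barycentric⇒hull μ μλ≡1 (side s≤x+y) (side y≤r) (side x≤c)
    where
    side : ∀ {p q} → q ≤ p → 0ℚ ≤ (q - p) * μ
    side q≤p = ≤0*≤0 (q≤p⇒q-p≤0 q≤p) μ≤0

-- Probing a triangle at a perturbed point

-- Whether v lies above t after an infinitesimal perturbation of v, upwards (true) or downwards (false).
Above : Bool → ℚ → ℚ → Set
Above true  t v = t ≤ v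
Above false t v = t < v

above? : ∀ σ t v → Dec (Above σ t v)
above? true  = ℚ._≤?_
above? false = ℚ._<?_

above⇒≤ : ∀ σ {t v} → Above σ t v → t ≤ v
above⇒≤ true  = λ t≤v → t≤v
above⇒≤ false = ℚ.<⇒≤

<⇒above : ∀ σ {t v} → t < v → Above σ t v
<⇒above true  = ℚ.<⇒≤
<⇒above false = λ t<v → t<v

above-≤ : ∀ σ {t v w} → Above σ t v → v ≤ w → Above σ t w
above-≤ true  = ℚ.≤-trans
above-≤ false = ℚ.<-≤-trans

≤-above : ∀ σ {s t v} → s ≤ t → Above σ t v → Above σ s v
≤-above true  = ℚ.≤-trans
≤-above false = ℚ.≤-<-trans

¬above⇒above-not : ∀ σ {t v} → ¬ Above σ t v → Above (not σ) v t
¬above⇒above-not true  = ℚ.≰⇒>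
¬above⇒above-not false = ℚ.≮⇒≥

above-not⇒¬above : ∀ σ {t v} → Above (not σ) v t → ¬ Above σ t v
above-not⇒¬above true  v<t t≤v = <⇒≱ v<t t≤v
above-not⇒¬above false v≤t t<v = <⇒≱ t<v v≤t

¬above⇒≥ : ∀ σ {t v} → ¬ Above σ t v → v ≤ t
¬above⇒≥ σ ¬above = above⇒≤ (not σ) (¬above⇒above-not σ ¬above)

-- The signs that dx, dy and dx + dy can take simultaneously.
Admissible : Bool → Bool → Bool → Set
Admissible true  true  υ = υ ≡ true
Admissible true  false υ = ⊤
Admissible false true  υ = ⊤
Admissible false false υ = υ ≡ false

admissible-not : ∀ σ τ υ → Admissible σ τ υ → Admissible (not σ) (not τ) (not υ)
admissible-not true  true  υ refl = refl
admissible-not true  false υ tt   = tt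
admissible-not false true  υ tt   = tt
admissible-not false false υ refl = refl

-- Equal signs force the sign of the sum; with opposite signs one of the two inequalities is strict,
-- hence so is their sum, and `υ` is free.
above-+ : ∀ σ τ υ {s t x y} → Admissible σ τ υ → Above σ s x → Above τ t y → Above υ (s + t) (x + y)
above-+ true  true  _ refl p q = ℚ.+-mono-≤ p q
above-+ true  false υ tt   p q = <⇒above υ (ℚ.+-mono-≤-< p q)
above-+ false true  υ tt   p q = <⇒above υ (ℚ.+-mono-<-≤ p q)
above-+ false false _ refl p q = ℚ.+-mono-< p q

-- x, y, z say on which side of its column, row and symbol line a point lies.
inside : Bool → Bool → Bool → ℕ
inside true  true  false = 1
inside false false true  = 1
inside _     _     _     = 0

⟦_⟧ : Bool → ℕ
⟦ b ⟧ = if b then 1 else 0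

-- In xy(1-z) + (1-x)(1-y)z the cubic terms cancel; the rest depends on pairs of coordinates only,
-- and these T* and T△ have in common.
inside-quadratic : ∀ x y z → inside x y z ℕ.+ (⟦ x ∧ z ⟧ ℕ.+ ⟦ y ∧ z ⟧) ≡ ⟦ x ∧ y ⟧ ℕ.+ ⟦ z ⟧
inside-quadratic true  true  true  = refl
inside-quadratic true  true  false = refl
inside-quadratic true  false true  = refl
inside-quadratic true  false false = refl
inside-quadratic false true  true  = refl
inside-quadratic false true  false = refl
inside-quadratic false false true  = refl
inside-quadratic false false false = refl

inside≤1 : ∀ x y z → inside x y z ℕ.≤ 1
inside≤1 true  true  true  = z≤n
inside≤1 true  true  false = s≤s z≤n
inside≤1 true  false z     = z≤n
inside≤1 false true  z     = z≤n
inside≤1 false false true  = s≤s z≤n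
inside≤1 false false false = z≤n

module Probe (σ τ υ : Bool) (x y : ℚ) where

  hits : ℚ → ℚ → ℚ → ℕ
  hits r c s = inside (does (above? σ c x)) (does (above? τ r y)) (does (above? υ s (x + y)))

  module _ {r c s : ℚ} where

    hits-up : Above σ c x → Above τ r y → ¬ Above υ s (x + y) → hits r c s ≡ 1
    hits-up p q ¬t
      rewrite dec-true (above? σ c x) p | dec-true (above? τ r y) q | dec-false (above? υ s (x + y)) ¬t = refl

    hits-down : ¬ Above σ c x → ¬ Above τ r y → Above υ s (x + y) → hits r c s ≡ 1
    hits-down ¬p ¬q t
      rewrite dec-false (above? σ c x) ¬p | dec-false (above? τ r y) ¬q | dec-true (above? υ s (x + y)) t = refl

    hits⇒ : 1 ℕ.≤ hits r c s →
            (Above σ c x × Above τ r y × ¬ Above υ s (x + y)) ⊎ (¬ Above σ c x × ¬ Above τ r y × Above υ s (x + y))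
    hits⇒ 1≤h with above? σ c x | above? τ r y | above? υ s (x + y)
    ... | yes p | yes q | no ¬t = inj₁ (p , q , ¬t)
    ... | no ¬p | no ¬q | yes t = inj₂ (¬p , ¬q , t)

    module _ (adm : Admissible σ τ υ) where

      -- If the size were not positive, adding the column and row inequalities would put the
      -- perturbed point beyond the symbol line as well. `down⇒size` is the mirror image with all
      -- signs reversed.
      up⇒size : Above σ c x → Above τ r y → ¬ Above υ s (x + y) → r + c < s
      up⇒size p q ¬t = ℚ.≰⇒> λ s≤r+c → ¬t
        (≤-above υ (subst (s ≤_) (ℚ.+-comm r c) s≤r+c) (above-+ σ τ υ adm p q))

      down⇒size : ¬ Above σ c x → ¬ Above τ r y → Above υ s (x + y) → s < r + c
      down⇒size ¬p ¬q t = ℚ.≰⇒> λ r+c≤s → above-not⇒¬above υ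
        (above-≤ (not υ)
          (above-+ (not σ) (not τ) (not υ) (admissible-not σ τ υ adm) (¬above⇒above-not σ ¬p) (¬above⇒above-not τ ¬q))
          (subst (_≤ s) (ℚ.+-comm r c) r+c≤s))
        t

      -- A hit forces a strict inequality between `r + c` and `s`. The bound has the form that
      -- `sum≤-except` expects.
      hits-degenerate : r + c ≡ s → hits r c s ℕ.≤ 0
      hits-degenerate r+c≡s with hits r c s in eq
      ... | zero  = z≤n
      ... | suc _ with hits⇒ (subst (1 ℕ.≤_) (sym eq) (s≤s z≤n))
      ...   | inj₁ (p , q , ¬t) = contradiction (up⇒size p q ¬t) (ℚ.<-irrefl r+c≡s)
      ...   | inj₂ (¬p , ¬q , t) = contradiction (down⇒size ¬p ¬q t) (ℚ.<-irrefl (sym r+c≡s))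

module _ {r c s x y : ℚ} where

  HitSomehow : Set
  HitSomehow = ∃[ σ ] ∃[ τ ] ∃[ υ ] (Admissible σ τ υ × Probe.hits σ τ υ x y r c s ≡ 1)

  -- The point is moved towards a side it does not lie on and off the other two lines. It cannot lie
  -- on all three lines, since the size is positive.
  up⇒hit : r + c < s → c ≤ x → r ≤ y → x + y ≤ s → HitSomehow
  up⇒hit r+c<s c≤x r≤y x+y≤s with x + y ℚ.<? s | c ℚ.<? x | r ℚ.<? y
  ... | yes x+y<s | _ | _ = true , true , true , refl ,
    Probe.hits-up true true true x y c≤x r≤y (<⇒≱ x+y<s)
  ... | no _ | yes c<x | _ = false , true , false , tt ,
    Probe.hits-up false true false x y c<x r≤y (≤⇒≯ x+y≤s)
  ... | no _ | no _ | yes r<y = true , false , false , tt ,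
    Probe.hits-up true false false x y c≤x r<y (≤⇒≯ x+y≤s)
  ... | no x+y≮s | no c≮x | no r≮y = contradiction
    (ℚ.≤-trans (ℚ.≮⇒≥ x+y≮s) (subst (x + y ≤_) (ℚ.+-comm c r) (ℚ.+-mono-≤ (ℚ.≮⇒≥ c≮x) (ℚ.≮⇒≥ r≮y))))
    (<⇒≱ r+c<s)

  down⇒hit : s < r + c → x ≤ c → y ≤ r → s ≤ x + y → HitSomehow
  down⇒hit s<r+c x≤c y≤r s≤x+y with s ℚ.<? x + y | x ℚ.<? c | y ℚ.<? r
  ... | yes s<x+y | _ | _ = false , false , false , refl ,
    Probe.hits-down false false false x y (≤⇒≯ x≤c) (≤⇒≯ y≤r) s<x+y
  ... | no _ | yes x<c | _ = true , false , true , tt ,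
    Probe.hits-down true false true x y (<⇒≱ x<c) (≤⇒≯ y≤r) s≤x+y
  ... | no _ | no _ | yes y<r = false , true , true , tt ,
    Probe.hits-down false true true x y (≤⇒≯ x≤c) (<⇒≱ y<r) s≤x+y
  ... | no s≮x+y | no x≮c | no y≮r = contradiction
    (ℚ.≤-trans (subst (_≤ x + y) (ℚ.+-comm c r) (ℚ.+-mono-≤ (ℚ.≮⇒≥ x≮c) (ℚ.≮⇒≥ y≮r))) (ℚ.≮⇒≥ s≮x+y))
    (<⇒≱ s<r+c)

-- The dissection

r₀≢c₁ : r₀ ≢ c₁
r₀≢c₁ ()

r₀≢s₂ : r₀ ≢ s₂
r₀≢s₂ ()

c₁≢s₂ : c₁ ≢ s₂
c₁≢s₂ ()

triple-≡ : ∀ {p q} → (∀ i → coord i p ≡ coord i q) → p ≡ q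
triple-≡ eq = cong₂ _,_ (eq r₀) (cong₂ _,_ (eq c₁) (eq s₂))

_≟ᵗ_ : (p q : Triple) → Dec (p ≡ q)
_≟ᵗ_ = Product.≡-dec ℕ._≟_ (Product.≡-dec ℕ._≟_ ℕ._≟_)

module Solved {T* T△ : List Triple} (bitrade : IsBitrade T* T△) {a : Triple} (a∈T* : a ∈ T*)
              (f : Assignment) (solves : SolvesEq T* a f) (separated : SeparatedSolution T* f) where

  open IsBitrade bitrade

  *→△ : ∀ r s → r ≢ s → Partners T* T△ r s
  *→△ r s r≢s p p∈T* = R2 p p∈T* r s r≢s

  △→* : ∀ r s → r ≢ s → Partners T△ T* r s
  △→* r s r≢s q q∈T△ = R3 q q∈T△ r s r≢s

  *≢△ : ∀ {p q} → p ∈ T* → q ∈ T△ → p ≢ q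
  *≢△ p∈T* q∈T△ refl = R1 _ p∈T* q∈T△

  val : Fin 3 → Triple → ℚ
  val i t = f i (coord i t)

  width : Triple → ℚ
  width t = size△ (val r₀ t) (val c₁ t) (val s₂ t)

  equation : ∀ {b} → b ∈ T* → b ≢ a → val r₀ b + val c₁ b ≡ val s₂ b
  equation = proj₁ solves _

  separated* : ∀ i {b d} → b ∈ T* → d ∈ T* → val i b ≡ val i d → coord i b ≡ coord i d
  separated* i b∈ d∈ = Equivalence.to (separated _ _ b∈ d∈ i)

  other : Fin 3 → Fin 3
  other zero    = c₁
  other (suc _) = r₀

  ≢other : ∀ i → i ≢ other i
  ≢other zero          ()
  ≢other (suc zero)    ()
  ≢other (suc (suc _)) ()

  occurs : ∀ i {c} → c ∈ T△ → ∃[ b ] (b ∈ T* × coord i c ≡ coord i b)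
  occurs i c∈T△ with (b , b∈T* , eq , _) , _ ← △→* i (other i) (≢other i) _ c∈T△ = b , b∈T* , eq

  -- Separation is assumed on `T*` only; the label of `c` is borrowed from an element of `T*` in
  -- which it occurs.
  separated*△ : ∀ i {b c} → b ∈ T* → c ∈ T△ → val i b ≡ val i c → coord i b ≡ coord i c
  separated*△ i b∈ c∈ eq with d , d∈ , e ← occurs i c∈ =
    trans (separated* i b∈ d∈ (trans eq (cong (f i) e))) (sym e)

  separated△ : ∀ i {c d} → c ∈ T△ → d ∈ T△ → val i c ≡ val i d → coord i c ≡ coord i d
  separated△ i c∈ d∈ eq with b , b∈ , e ← occurs i c∈ =
    trans e (separated*△ i b∈ d∈ (trans (cong (f i) (sym e)) eq))

  agree△⇒≡ : ∀ r s → r ≢ s → ∀ {c d} → c ∈ T△ → d ∈ T△ → Agree r s c d → c ≡ d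
  agree△⇒≡ r s r≢s = agree⇒≡ r s (△→* r s r≢s) (*→△ r s r≢s)

  -- If the lines of c are concurrent, the partner of c through two of them lies on the third as well.
  nondegenerate : ∀ {c} → c ∈ T△ → val r₀ c + val c₁ c ≢ val s₂ c
  nondegenerate {c} c∈ eq
    with (q , q∈ , qr , qs) , _ ← △→* r₀ s₂ r₀≢s₂ c c∈
       | (q′ , q′∈ , q′c , q′s) , _ ← △→* c₁ s₂ c₁≢s₂ c c∈
    -- Only a partner different from `a` satisfies an equation, which then yields the missing
    -- coordinate. If both partners are `a`, then `c` agrees with `a` in every coordinate. In all
    -- cases `c` would lie in `T*`.
    with q ≟ᵗ a | q′ ≟ᵗ a
  ... | yes refl | yes refl = *≢△ q∈ c∈ (triple-≡ λ where
      zero             → sym qr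
      (suc zero)       → sym q′c
      (suc (suc zero)) → sym qs)
  ... | no q≢a | _ = *≢△ q∈ c∈ (triple-≡ λ where
      zero             → sym qr
      (suc zero)       → separated*△ c₁ q∈ c∈ (+-cancelˡ (val r₀ c) (val c₁ q) (val c₁ c) (begin
        val r₀ c + val c₁ q ≡⟨ cong (λ n → f r₀ n + val c₁ q) qr ⟩
        val r₀ q + val c₁ q ≡⟨ equation q∈ q≢a ⟩
        val s₂ q            ≡⟨ cong (f s₂) qs ⟨
        val s₂ c            ≡⟨ eq ⟨
        val r₀ c + val c₁ c ∎))
      (suc (suc zero)) → sym qs)
    where open ≡-Reasoning
  ... | yes _ | no q′≢a = *≢△ q′∈ c∈ (triple-≡ λ where
      zero             → separated*△ r₀ q′∈ c∈ (+-cancelʳ (val c₁ c) (val r₀ q′) (val r₀ c) (begin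
        val r₀ q′ + val c₁ c  ≡⟨ cong (λ n → val r₀ q′ + f c₁ n) q′c ⟩
        val r₀ q′ + val c₁ q′ ≡⟨ equation q′∈ q′≢a ⟩
        val s₂ q′             ≡⟨ cong (f s₂) q′s ⟨
        val s₂ c              ≡⟨ eq ⟨
        val r₀ c + val c₁ c   ∎))
      (suc zero)       → sym q′c
      (suc (suc zero)) → sym q′s)
    where open ≡-Reasoning

  ¬degenerate : ∀ c → c ∈ T△ → ¬ Degenerate f c
  ¬degenerate c c∈ (x , y , refl , refl , x+y≡s) = nondegenerate c∈ (trans (ℚ.+-comm y x) x+y≡s)

  up-or-down : ∀ {c} → c ∈ T△ → val r₀ c + val c₁ c < val s₂ c ⊎ val s₂ c < val r₀ c + val c₁ c
  up-or-down {c} c∈ with ℚ.<-cmp (val r₀ c + val c₁ c) (val s₂ c)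
  ... | tri< lt _ _ = inj₁ lt
  ... | tri≈ _ eq _ = contradiction eq (nondegenerate c∈)
  ... | tri> _ _ gt = inj₂ gt

  up⇒width>0 : ∀ {c} → val r₀ c + val c₁ c < val s₂ c → 0ℚ < width c
  up⇒width>0 = p<q⇒0<q-p

  down⇒width<0 : ∀ {c} → val s₂ c < val r₀ c + val c₁ c → width c < 0ℚ
  down⇒width<0 {c} = <-shift (solve 2 (λ s t → t :- s := con 0ℚ :- (s :- t)) refl (val s₂ c) (val r₀ c + val c₁ c))
    where open +-*-Solver

  InΔ⇒up : ∀ {c x y} → val r₀ c + val c₁ c < val s₂ c → InΔ f c (x , y) →
           val c₁ c ≤ x × val r₀ c ≤ y × x + y ≤ val s₂ c
  InΔ⇒up {c} up = hull⇒up {val r₀ c} {val c₁ c} {val s₂ c} (up⇒width>0 {c} up)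

  InΔ⇒down : ∀ {c x y} → val s₂ c < val r₀ c + val c₁ c → InΔ f c (x , y) →
             x ≤ val c₁ c × y ≤ val r₀ c × val s₂ c ≤ x + y
  InΔ⇒down {c} down = hull⇒down {val r₀ c} {val c₁ c} {val s₂ c} (down⇒width<0 {c} down)

  -- Counting hits of a perturbed point

  module Counting (σ τ υ : Bool) (adm : Admissible σ τ υ) (x y : ℚ) where

    open Probe σ τ υ x y

    hit : Triple → ℕ
    hit t = hits (val r₀ t) (val c₁ t) (val s₂ t)

    X Y Z : ℕ → Bool
    X n = does (above? σ (f c₁ n) x)
    Y n = does (above? τ (f r₀ n) y)
    Z n = does (above? υ (f s₂ n) (x + y))

    -- Sums are transferred between `T*` and `T△` only for functions of coordinate pairs, so the
    -- single-coordinate term `Z′` is given a row to ignore.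
    XY XZ YZ Z′ : ℕ × ℕ → ℕ
    XY (k , l) = ⟦ X k ∧ Y l ⟧
    XZ (k , l) = ⟦ X k ∧ Z l ⟧
    YZ (k , l) = ⟦ Y k ∧ Z l ⟧
    Z′ (k , l) = ⟦ Z l ⟧

    Σxy Σxz Σyz Σz : List Triple → ℕ
    Σxy L = sum (map (XY ∘ coords c₁ r₀) L)
    Σxz L = sum (map (XZ ∘ coords c₁ s₂) L)
    Σyz L = sum (map (YZ ∘ coords r₀ s₂) L)
    Σz  L = sum (map (Z′ ∘ coords r₀ s₂) L)

    -- The negative terms of the polynomial are kept on the left, so that natural numbers suffice.
    Σhit-quadratic : ∀ L → sum (map hit L) ℕ.+ (Σxz L ℕ.+ Σyz L) ≡ Σxy L ℕ.+ Σz L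
    Σhit-quadratic []      = refl
    Σhit-quadratic (t ∷ L) = begin
      (hit t ℕ.+ S) ℕ.+ ((xz ℕ.+ Σxz L) ℕ.+ (yz ℕ.+ Σyz L))
        ≡⟨ ℕ-solve 6 (λ h S xz Sxz yz Syz →
             (h ∔ S) ∔ ((xz ∔ Sxz) ∔ (yz ∔ Syz)) ≐ (h ∔ (xz ∔ yz)) ∔ (S ∔ (Sxz ∔ Syz)))
             refl (hit t) S xz (Σxz L) yz (Σyz L) ⟩
      (hit t ℕ.+ (xz ℕ.+ yz)) ℕ.+ (S ℕ.+ (Σxz L ℕ.+ Σyz L))
        ≡⟨ cong₂ ℕ._+_ (inside-quadratic (X (coord c₁ t)) (Y (coord r₀ t)) (Z (coord s₂ t))) (Σhit-quadratic L) ⟩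
      (xy ℕ.+ z) ℕ.+ (Σxy L ℕ.+ Σz L)
        ≡⟨ ℕ-solve 4 (λ xy z Sxy Sz → (xy ∔ z) ∔ (Sxy ∔ Sz) ≐ (xy ∔ Sxy) ∔ (z ∔ Sz)) refl xy z (Σxy L) (Σz L) ⟩
      (xy ℕ.+ Σxy L) ℕ.+ (z ℕ.+ Σz L) ∎
      where
      open ≡-Reasoning
      open ℕ-Solver using () renaming (solve to ℕ-solve; _:+_ to _∔_; _:=_ to _≐_)
      S xy xz yz z : ℕ
      S  = sum (map hit L)
      xy = XY (coords c₁ r₀ t)
      xz = XZ (coords c₁ s₂ t)
      yz = YZ (coords r₀ s₂ t)
      z  = Z′ (coords r₀ s₂ t)

    Σ△≡Σ* : ∀ r s → r ≢ s → (g : ℕ × ℕ → ℕ) → sum (map (g ∘ coords r s) T△) ≡ sum (map (g ∘ coords r s) T*)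
    Σ△≡Σ* r s r≢s = sum-coords r s (△→* r s r≢s) (*→△ r s r≢s) uniq△ uniq*

    Σhit△≡Σhit* : sum (map hit T△) ≡ sum (map hit T*)
    Σhit△≡Σhit* = ℕ.+-cancelʳ-≡ (Σxz T* ℕ.+ Σyz T*) _ _ (begin
      sum (map hit T△) ℕ.+ (Σxz T* ℕ.+ Σyz T*) ≡⟨ cong (sum (map hit T△) ℕ.+_)
                                                   (cong₂ ℕ._+_ (Σ△≡Σ* c₁ s₂ c₁≢s₂ XZ) (Σ△≡Σ* r₀ s₂ r₀≢s₂ YZ)) ⟨
      sum (map hit T△) ℕ.+ (Σxz T△ ℕ.+ Σyz T△) ≡⟨ Σhit-quadratic T△ ⟩
      Σxy T△ ℕ.+ Σz T△                         ≡⟨ cong₂ ℕ._+_ (Σ△≡Σ* c₁ r₀ (r₀≢c₁ ∘ sym) XY) (Σ△≡Σ* r₀ s₂ r₀≢s₂ Z′) ⟩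
      Σxy T* ℕ.+ Σz T*                         ≡⟨ Σhit-quadratic T* ⟨
      sum (map hit T*) ℕ.+ (Σxz T* ℕ.+ Σyz T*) ∎)
      where open ≡-Reasoning

    hit-a : hit a ≡ hits 0ℚ 0ℚ 1ℚ
    hit-a = let _ , r≡0 , c≡0 , s≡1 = solves in
      trans (cong (λ r → hits r (val c₁ a) (val s₂ a)) r≡0) (cong₂ (hits 0ℚ) c≡0 s≡1)

    -- Away from a the elements of T* are degenerate triangles, so T△ hits a point as often as Σ does.
    Σhit : sum (map hit T△) ≡ hits 0ℚ 0ℚ 1ℚ
    Σhit = trans Σhit△≡Σhit* (trans (ℕ.≤-antisym upper (≤sum hit a∈T*)) hit-a)
      where
      upper : sum (map hit T*) ℕ.≤ hit a
      upper = subst₂ ℕ._≤_ (ℕ.+-identityʳ _)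
        (trans (cong (hit a ℕ.+_) (ℕ.*-zeroʳ (length T*))) (ℕ.+-identityʳ _))
        (sum≤-except hit 0 uniq* a∈T* λ b∈ b≢a → hits-degenerate adm (equation b∈ b≢a))

    hit⇒InΣ : 1 ℕ.≤ hits 0ℚ 0ℚ 1ℚ → InΣ (x , y)
    hit⇒InΣ 1≤h with hits⇒ 1≤h
    ... | inj₁ (p , q , ¬t) = above⇒≤ σ p , above⇒≤ τ q , ¬above⇒≥ υ ¬t
    ... | inj₂ (¬p , ¬q , t) = contradiction (down⇒size adm ¬p ¬q t) (≤⇒≯ (ℚ.nonNegative⁻¹ 1ℚ))

    hit⇒InΔ : ∀ {c} → 1 ℕ.≤ hit c → InΔ f c (x , y)
    hit⇒InΔ {c} 1≤h with hits⇒ 1≤h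
    ... | inj₁ (p , q , ¬t) = up⇒hull (up⇒width>0 {c} (up⇒size adm p q ¬t))
                                (above⇒≤ σ p) (above⇒≤ τ q) (¬above⇒≥ υ ¬t)
    ... | inj₂ (¬p , ¬q , t) = down⇒hull (down⇒width<0 {c} (down⇒size adm ¬p ¬q t))
                                 (¬above⇒≥ σ ¬p) (¬above⇒≥ τ ¬q) (above⇒≤ υ t)

    covered : 1 ℕ.≤ hits 0ℚ 0ℚ 1ℚ → ∃[ c ] (c ∈ T△ × InΔ f c (x , y))
    covered 1≤h with c , c∈ , 1≤hc ← sum>0⇒∃ hit T△ (subst (1 ℕ.≤_) (sym Σhit) 1≤h) = c , c∈ , hit⇒InΔ 1≤hc

    contained : ∀ {c} → c ∈ T△ → 1 ℕ.≤ hit c → InΣ (x , y)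
    contained c∈ 1≤h = hit⇒InΣ (subst (1 ℕ.≤_) Σhit (ℕ.≤-trans 1≤h (≤sum hit c∈)))

    hit-once : ∀ {c c′} → c ∈ T△ → c′ ∈ T△ → c ≢ c′ → hit c ≡ 1 → hit c′ ≡ 1 → ⊥
    hit-once c∈ c′∈ c≢c′ h h′ = ℕ.<⇒≱ (s≤s (s≤s z≤n))
      (ℕ.≤-trans (subst₂ (λ k l → k ℕ.+ l ℕ.≤ sum (map hit T△)) h h′ (+≤sum hit c∈ c′∈ c≢c′))
        (subst (ℕ._≤ 1) (sym Σhit) (inside≤1 (does (above? σ 0ℚ x)) (does (above? τ 0ℚ y)) _)))

  hit⇒covered : ∀ {x y} → HitSomehow {0ℚ} {0ℚ} {1ℚ} {x} {y} → ∃[ c ] (c ∈ T△ × InΔ f c (x , y))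
  hit⇒covered {x} {y} (σ , τ , υ , adm , h) = Counting.covered σ τ υ adm x y (ℕ.≤-reflexive (sym h))

  hit⇒contained : ∀ {c x y} → c ∈ T△ → HitSomehow {val r₀ c} {val c₁ c} {val s₂ c} {x} {y} → InΣ (x , y)
  hit⇒contained {c} {x} {y} c∈ (σ , τ , υ , adm , h) =
    Counting.contained σ τ υ adm x y c∈ (ℕ.≤-reflexive (sym h))

  -- A point of a closed triangle is hit after a suitable perturbation, and for each perturbation
  -- the counts for `T△` and Σ agree; a hit in turn puts the unperturbed point in the closed
  -- triangle.
  covers : CoversΣ T△ f
  covers (x , y) = mk⇔ to from
    where
    to : InΣ (x , y) → ∃[ c ] (c ∈ T△ × InΔ f c (x , y))
    to (0≤x , 0≤y , x+y≤1) = hit⇒covered (up⇒hit (ℚ.positive⁻¹ 1ℚ) 0≤x 0≤y x+y≤1)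
    from : ∃[ c ] (c ∈ T△ × InΔ f c (x , y)) → InΣ (x , y)
    from (c , c∈ , p∈Δ) with up-or-down c∈
    ... | inj₁ up   = let c≤x , r≤y , x+y≤s = InΔ⇒up {c} up p∈Δ in
                      hit⇒contained c∈ (up⇒hit up c≤x r≤y x+y≤s)
    ... | inj₂ down = let x≤c , y≤r , s≤x+y = InΔ⇒down {c} down p∈Δ in
                      hit⇒contained c∈ (down⇒hit down x≤c y≤r s≤x+y)

  -- A single perturbation serves all triangles, as `hit-once` requires. The strict inequalities
  -- come from comparing the point with one shifted by `δ` that is still in the triangle.
  interior⇒hit : ∀ {c x y} → c ∈ T△ → IsInteriorPoint (InΔ f c) (x , y) → Counting.hit true true true refl x y c ≡ 1
  interior⇒hit {c} {x} {y} c∈ (ε , 0<ε , ball) with δ , 0<δ , δ<ε ← ℚ.<-dense 0<ε = go (up-or-down c∈)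
    where
    open +-*-Solver
    p+δ-p : ∀ p → (p + δ) - p ≡ δ
    p+δ-p p = solve 2 (λ p δ → (p :+ δ) :- p := δ) refl p δ
    near : ∀ p → ∣ (p + δ) - p ∣ < ε
    near p = subst (_< ε) (sym (trans (cong ∣_∣ (p+δ-p p)) (ℚ.0≤p⇒∣p∣≡p (ℚ.<⇒≤ 0<δ)))) δ<ε
    centre : ∀ p → ∣ p - p ∣ < ε
    centre p = subst (λ z → ∣ z ∣ < ε) (sym (ℚ.+-inverseʳ p)) 0<ε
    p<p+δ : ∀ p → p < p + δ
    p<p+δ p = <-shift (solve 2 (λ p δ → δ :- con 0ℚ := (p :+ δ) :- p) refl p δ) 0<δ
    go : val r₀ c + val c₁ c < val s₂ c ⊎ val s₂ c < val r₀ c + val c₁ c → Counting.hit true true true refl x y c ≡ 1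
    go (inj₁ up) =
      let c≤x , r≤y , _     = InΔ⇒up {c} up (ball x y (centre x) (centre y))
          _ , _ , x+δ+y≤s   = InΔ⇒up {c} up (ball (x + δ) y (near x) (centre y)) in
      Probe.hits-up true true true x y {s = val s₂ c} c≤x r≤y
        (<⇒≱ (ℚ.<-≤-trans (ℚ.+-monoˡ-< y (p<p+δ x)) x+δ+y≤s))
    go (inj₂ down) =
      let _ , _ , s≤x+y = InΔ⇒down {c} down (ball x y (centre x) (centre y))
          x+δ≤c , _ , _ = InΔ⇒down {c} down (ball (x + δ) y (near x) (centre y))
          _ , y+δ≤r , _ = InΔ⇒down {c} down (ball x (y + δ) (centre x) (near y)) in
      Probe.hits-down true true true x y {s = val s₂ c} (<⇒≱ (ℚ.<-≤-trans (p<p+δ x) x+δ≤c))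
        (<⇒≱ (ℚ.<-≤-trans (p<p+δ y) y+δ≤r)) s≤x+y

  disjoint : InteriorsDisjoint T△ f
  disjoint c c′ c∈ c′∈ c≢c′ (x , y) (int , int′) =
    Counting.hit-once true true true refl x y c∈ c′∈ c≢c′ (interior⇒hit c∈ int) (interior⇒hit c′∈ int′)

  -- Vertices of the triangles

  vertex : Fin 3 → Triple → Point
  vertex zero             = vert₁ f
  vertex (suc zero)       = vert₂ f
  vertex (suc (suc zero)) = vert₃ f

  vertex-kind : ∀ {c p} → IsVertexOfΔ f c p → ∃[ k ] p ≡ vertex k c
  vertex-kind (inj₁ eq)        = zero , eq
  vertex-kind (inj₂ (inj₁ eq)) = suc zero , eq
  vertex-kind (inj₂ (inj₂ eq)) = suc (suc zero) , eq

  -- The `k`-th vertex lies on two of the three lines, so the point gives two of the values;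
  -- separation turns these into labels, and two labels determine a triple of `T△`.
  vertex-unique : ∀ k {c d p} → c ∈ T△ → d ∈ T△ → p ≡ vertex k c → p ≡ vertex k d → c ≡ d
  vertex-unique zero c∈ d∈ refl eq = agree△⇒≡ r₀ c₁ r₀≢c₁ c∈ d∈
    (separated△ r₀ c∈ d∈ (cong proj₂ eq) , separated△ c₁ c∈ d∈ (cong proj₁ eq))
  vertex-unique (suc zero) {c} {d} c∈ d∈ refl eq = agree△⇒≡ c₁ s₂ c₁≢s₂ c∈ d∈
    (separated△ c₁ c∈ d∈ (cong proj₁ eq) ,
     separated△ s₂ c∈ d∈ (+-cancelʳ (- val c₁ c) (val s₂ c) (val s₂ d)
       (trans (cong proj₂ eq) (cong (λ z → val s₂ d - z) (sym (cong proj₁ eq))))))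
  vertex-unique (suc (suc zero)) {c} {d} c∈ d∈ refl eq = agree△⇒≡ r₀ s₂ r₀≢s₂ c∈ d∈
    (separated△ r₀ c∈ d∈ (cong proj₂ eq) ,
     separated△ s₂ c∈ d∈ (+-cancelʳ (- val r₀ c) (val s₂ c) (val s₂ d)
       (trans (cong proj₁ eq) (cong (λ z → val s₂ d - z) (sym (cong proj₂ eq))))))

  -- There are three kinds of vertex, so by the pigeonhole principle two of the listed triangles
  -- have `p` as a vertex of the same kind.
  no-sixfold-vertex : NoSixfoldVertex T△ f
  no-sixfold-vertex p L uL |L|≡6 L⊆T△ vertices =
    let i , j , i<j , same = pigeonhole (subst (3 ℕ.<_) (sym |L|≡6) (s≤s (s≤s (s≤s (s≤s z≤n))))) (proj₁ ∘ kind) in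
    Fin.<⇒≢ i<j (lookup-injective uL (vertex-unique (proj₁ (kind i))
      (All.lookup L⊆T△ (∈-lookup i)) (All.lookup L⊆T△ (∈-lookup j))
      (proj₂ (kind i)) (subst (λ k → p ≡ vertex k (lookup L j)) (sym same) (proj₂ (kind j)))))
    where
    kind : ∀ i → ∃[ k ] p ≡ vertex k (lookup L i)
    kind i = vertex-kind (All.lookup vertices (∈-lookup i))

-- Segments on the lines of a dissection

-- ℓ i is constant on the lines of direction i, and pos i is a coordinate along them; the signs of
-- pos are such that every triangle is traversed cyclically (see ends-width).
ℓ : Fin 3 → Point → ℚ
ℓ zero             (x , y) = y
ℓ (suc zero)       (x , y) = x
ℓ (suc (suc zero)) (x , y) = x + y

pos : Fin 3 → Point → ℚ
pos zero             (x , y) = x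
pos (suc zero)       (x , y) = - y
pos (suc (suc zero)) (x , y) = y

Between : ℚ → ℚ → ℚ → Set
Between u w p = (u ≤ p × p ≤ w) ⊎ (w ≤ p × p ≤ u)

between? : ∀ u w p → Dec (Between u w p)
between? u w p = (u ℚ.≤? p ×-dec p ℚ.≤? w) ⊎-dec (w ℚ.≤? p ×-dec p ℚ.≤? u)

lerp : ℚ → ℚ → ℚ → ℚ
lerp t u w = (1ℚ - t) * u + t * w

lerp-const : ∀ t v → lerp t v v ≡ v
lerp-const = solve 2 (λ t v → (con 1ℚ :- t) :* v :+ t :* v := v) refl
  where open +-*-Solver

lerp-swap : ∀ t u w → lerp t w u ≡ lerp (1ℚ - t) u w
lerp-swap = solve 3 (λ t u w → (con 1ℚ :- t) :* w :+ t :* u := (con 1ℚ :- (con 1ℚ :- t)) :* u :+ (con 1ℚ :- t) :* w) refl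
  where open +-*-Solver

lerp-bounds : ∀ {t u w} → 0ℚ ≤ t → t ≤ 1ℚ → u ≤ w → u ≤ lerp t u w × lerp t u w ≤ w
lerp-bounds {t} {u} {w} 0≤t t≤1 u≤w =
  0≤q-p⇒p≤q (subst (0ℚ ≤_)
    (solve 3 (λ t u w → t :* (w :- u) := ((con 1ℚ :- t) :* u :+ t :* w) :- u) refl t u w)
    (0≤*0≤ 0≤t (p≤q⇒0≤q-p u≤w))) ,
  0≤q-p⇒p≤q (subst (0ℚ ≤_)
    (solve 3 (λ t u w → (con 1ℚ :- t) :* (w :- u) := w :- ((con 1ℚ :- t) :* u :+ t :* w)) refl t u w)
    (0≤*0≤ (p≤q⇒0≤q-p t≤1) (p≤q⇒0≤q-p u≤w)))
  where open +-*-Solver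

0≤1-t : ∀ {t} → t ≤ 1ℚ → 0ℚ ≤ 1ℚ - t
0≤1-t = p≤q⇒0≤q-p

1-t≤1 : ∀ {t} → 0ℚ ≤ t → 1ℚ - t ≤ 1ℚ
1-t≤1 {t} = ≤-shift (solve 1 (λ t → t :- con 0ℚ := con 1ℚ :- (con 1ℚ :- t)) refl t)
  where open +-*-Solver

lerp-between : ∀ {t u w} → 0ℚ ≤ t → t ≤ 1ℚ → Between u w (lerp t u w)
lerp-between {t} {u} {w} 0≤t t≤1 with ℚ.≤-total u w
... | inj₁ u≤w = inj₁ (lerp-bounds 0≤t t≤1 u≤w)
... | inj₂ w≤u = inj₂ (subst (λ p → w ≤ p × p ≤ u)
  (trans (lerp-swap (1ℚ - t) u w) (cong (λ s → lerp s u w) (solve 1 (λ t → con 1ℚ :- (con 1ℚ :- t) := t) refl t)))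
  (lerp-bounds (0≤1-t t≤1) (1-t≤1 0≤t) w≤u))
  where open +-*-Solver

bounds-lerp : ∀ {u w p} → u < w → u ≤ p → p ≤ w → ∃[ t ] (0ℚ ≤ t × t ≤ 1ℚ × p ≡ lerp t u w)
bounds-lerp {u} {w} {p} u<w u≤p p≤w = fromInverse (inverse⁺ (p<q⇒0<q-p u<w))
  where
  open +-*-Solver
  fromInverse : ∃[ μ ] (0ℚ ≤ μ × μ * (w - u) ≡ 1ℚ) → ∃[ t ] (0ℚ ≤ t × t ≤ 1ℚ × p ≡ lerp t u w)
  fromInverse (μ , 0≤μ , μd≡1) =
    (p - u) * μ , 0≤*0≤ (p≤q⇒0≤q-p u≤p) 0≤μ ,
    0≤q-p⇒p≤q (subst (0ℚ ≤_)
      (trans (solve 4 (λ u w p μ → (w :- p) :* μ := μ :* (w :- u) :- (p :- u) :* μ) refl u w p μ)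
        (cong (_- (p - u) * μ) μd≡1))
      (0≤*0≤ (p≤q⇒0≤q-p p≤w) 0≤μ)) ,
    (begin
      p                               ≡⟨ solve 2 (λ u p → p := u :+ (p :- u) :* con 1ℚ) refl u p ⟩
      u + (p - u) * 1ℚ                ≡⟨ cong (λ z → u + (p - u) * z) μd≡1 ⟨
      u + (p - u) * (μ * (w - u))     ≡⟨ solve 4 (λ u w p μ →
                                           u :+ (p :- u) :* (μ :* (w :- u)) :=
                                           (con 1ℚ :- (p :- u) :* μ) :* u :+ (p :- u) :* μ :* w) refl u w p μ ⟩
      lerp ((p - u) * μ) u w          ∎)
    where open ≡-Reasoning

between-lerp : ∀ {u w p} → u ≢ w → Between u w p → ∃[ t ] (0ℚ ≤ t × t ≤ 1ℚ × p ≡ lerp t u w)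
between-lerp {u} {w} {p} u≢w (inj₁ (u≤p , p≤w)) =
  bounds-lerp (≤∧≢⇒< (ℚ.≤-trans u≤p p≤w) u≢w) u≤p p≤w
between-lerp {u} {w} {p} u≢w (inj₂ (w≤p , p≤u)) =
  let t , 0≤t , t≤1 , p≡ = bounds-lerp (≤∧≢⇒< (ℚ.≤-trans w≤p p≤u) (u≢w ∘ sym)) w≤p p≤u in
  1ℚ - t , 0≤1-t t≤1 , 1-t≤1 0≤t , trans p≡ (lerp-swap t u w)

between-> : ∀ {u w p t} → t < u → t < w → Between u w p → t < p
between-> t<u _ (inj₁ (u≤p , _)) = ℚ.<-≤-trans t<u u≤p
between-> _ t<w (inj₂ (w≤p , _)) = ℚ.<-≤-trans t<w w≤p

between-≤ : ∀ {u w p t} → u ≤ t → w ≤ t → Between u w p → p ≤ t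
between-≤ _ w≤t (inj₁ (_ , p≤w)) = ℚ.≤-trans p≤w w≤t
between-≤ u≤t _ (inj₂ (_ , p≤u)) = ℚ.≤-trans p≤u u≤t

ℓ-lerp : ∀ i p q t → ℓ i (((1ℚ - t) · p) ⊕ (t · q)) ≡ lerp t (ℓ i p) (ℓ i q)
ℓ-lerp zero             p q t = refl
ℓ-lerp (suc zero)       p q t = refl
ℓ-lerp (suc (suc zero)) (x , y) (x′ , y′) t =
  solve 5 (λ t x y x′ y′ →
    ((con 1ℚ :- t) :* x :+ t :* x′) :+ ((con 1ℚ :- t) :* y :+ t :* y′) := (con 1ℚ :- t) :* (x :+ y) :+ t :* (x′ :+ y′))
    refl t x y x′ y′
  where open +-*-Solver

pos-lerp : ∀ i p q t → pos i (((1ℚ - t) · p) ⊕ (t · q)) ≡ lerp t (pos i p) (pos i q)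
pos-lerp zero             p q t = refl
pos-lerp (suc zero)       (_ , y) (_ , y′) t =
  solve 3 (λ t y y′ → :- ((con 1ℚ :- t) :* y :+ t :* y′) := (con 1ℚ :- t) :* (:- y) :+ t :* (:- y′)) refl t y y′
  where open +-*-Solver
pos-lerp (suc (suc zero)) p q t = refl

point-≡ : ∀ i {p q} → ℓ i p ≡ ℓ i q → pos i p ≡ pos i q → p ≡ q
point-≡ zero             ly lx = cong₂ _,_ lx ly
point-≡ (suc zero)       lx ly = cong₂ _,_ lx (ℚ.neg-injective ly)
point-≡ (suc (suc zero)) {x , y} {x′ , y′} ls refl = cong (_, y) (+-cancelʳ y x x′ ls)

module _ (i : Fin 3) {v : ℚ} {u w : Point} (ℓu : ℓ i u ≡ v) (ℓw : ℓ i w ≡ v) where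

  segment⇒ : ∀ {q} → OnSegment u w q → ℓ i q ≡ v × Between (pos i u) (pos i w) (pos i q)
  segment⇒ (t , 0≤t , t≤1 , refl) =
    trans (ℓ-lerp i u w t) (trans (cong₂ (lerp t) ℓu ℓw) (lerp-const t v)) ,
    subst (Between (pos i u) (pos i w)) (sym (pos-lerp i u w t)) (lerp-between 0≤t t≤1)

  ⇒segment : pos i u ≢ pos i w → ∀ {q} → ℓ i q ≡ v → Between (pos i u) (pos i w) (pos i q) → OnSegment u w q
  ⇒segment u≢w ℓq btw =
    let t , 0≤t , t≤1 , eq = between-lerp u≢w btw in
    t , 0≤t , t≤1 , point-≡ i
      (trans ℓq (sym (trans (ℓ-lerp i u w t) (trans (cong₂ (lerp t) ℓu ℓw) (lerp-const t v)))))
      (trans eq (sym (pos-lerp i u w t)))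

start∈segment : ∀ u w → OnSegment u w u
start∈segment (x , y) (x′ , y′) = 0ℚ , ℚ.≤-refl , ℚ.nonNegative⁻¹ 1ℚ , cong₂ _,_ (eq x x′) (eq y y′)
  where
  open +-*-Solver
  eq : ∀ p q → p ≡ (1ℚ - 0ℚ) * p + 0ℚ * q
  eq = solve 2 (λ p q → p := (con 1ℚ :- con 0ℚ) :* p :+ con 0ℚ :* q) refl

end∈segment : ∀ u w → OnSegment u w w
end∈segment (x , y) (x′ , y′) = 1ℚ , ℚ.nonNegative⁻¹ 1ℚ , ℚ.≤-refl , cong₂ _,_ (eq x x′) (eq y y′)
  where
  open +-*-Solver
  eq : ∀ p q → q ≡ (1ℚ - 1ℚ) * p + 1ℚ * q
  eq = solve 2 (λ p q → q := (con 1ℚ :- con 1ℚ) :* p :+ con 1ℚ :* q) refl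

-- The equation of a line in the coordinates `ℓ i` and `pos i`

module _ (L : Line) where
  open Line L

  -- The partial derivatives of the form αx + βy with respect to the coordinates `ℓ i` and `pos i`.
  ∂ℓ ∂pos : Fin 3 → ℚ
  ∂ℓ zero    = β
  ∂ℓ (suc _) = α
  ∂pos zero             = α
  ∂pos (suc zero)       = - β
  ∂pos (suc (suc zero)) = β - α

  line-eq : ∀ i q → α * proj₁ q + β * proj₂ q ≡ ∂ℓ i * ℓ i q + ∂pos i * pos i q
  line-eq zero (x , y) = ℚ.+-comm (α * x) (β * y)
  line-eq (suc zero) (x , y) =
    solve 4 (λ α β x y → α :* x :+ β :* y := α :* x :+ (:- β) :* (:- y)) refl α β x y
    where open +-*-Solver
  line-eq (suc (suc zero)) (x , y) =
    solve 4 (λ α β x y → α :* x :+ β :* y := α :* (x :+ y) :+ (β :- α) :* y) refl α β x y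
    where open +-*-Solver

  -- Says that `L` is the line on which `ℓ i` equals `v`; working with coefficients covers every
  -- scalar multiple of its equation.
  IsLevel : Fin 3 → ℚ → Set
  IsLevel i v = ∂pos i ≡ 0ℚ × ∂ℓ i * v ≡ κ

  -- Subtracting the equations at two points of equal `ℓ i` leaves `∂pos i` times a nonzero
  -- difference.
  onLine⇒isLevel : ∀ i {v u w} → ℓ i u ≡ v → ℓ i w ≡ v → pos i u ≢ pos i w → OnLine L u → OnLine L w → IsLevel i v
  onLine⇒isLevel i {v} {u} {w} refl ℓw u≢w Lu Lw = ∂pos≡0 , (begin
    ∂ℓ i * v                     ≡⟨ solve 3 (λ e v p → e :* v := e :* v :+ con 0ℚ :* p) refl (∂ℓ i) v (pos i u) ⟩
    ∂ℓ i * v + 0ℚ * pos i u      ≡⟨ cong (λ z → ∂ℓ i * v + z * pos i u) ∂pos≡0 ⟨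
    ∂ℓ i * v + ∂pos i * pos i u  ≡⟨ line-eq i u ⟨
    α * proj₁ u + β * proj₂ u    ≡⟨ Lu ⟩
    κ                            ∎)
    where
    open +-*-Solver
    open ≡-Reasoning
    ∂pos≡0 : ∂pos i ≡ 0ℚ
    ∂pos≡0 = p*q≡0⇒p≡0 {q = pos i u - pos i w} (u≢w ∘ p-q≡0⇒p≡q) (begin
      ∂pos i * (pos i u - pos i w)
        ≡⟨ solve 4 (λ m d p q → d :* (p :- q) := (m :+ d :* p) :- (m :+ d :* q)) refl (∂ℓ i * v) (∂pos i) (pos i u) (pos i w) ⟩
      (∂ℓ i * v + ∂pos i * pos i u) - (∂ℓ i * v + ∂pos i * pos i w)
        ≡⟨ cong₂ _-_ (trans (sym (line-eq i u)) Lu)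
             (trans (cong (λ z → ∂ℓ i * z + ∂pos i * pos i w) (sym ℓw)) (trans (sym (line-eq i w)) Lw)) ⟩
      κ - κ
        ≡⟨ ℚ.+-inverseʳ κ ⟩
      0ℚ ∎)

  isLevel⇒onLine : ∀ i {v q} → IsLevel i v → ℓ i q ≡ v → OnLine L q
  isLevel⇒onLine i {v} {q} (∂pos≡0 , ∂ℓv≡κ) refl = begin
    α * proj₁ q + β * proj₂ q    ≡⟨ line-eq i q ⟩
    ∂ℓ i * v + ∂pos i * pos i q  ≡⟨ cong (λ z → ∂ℓ i * v + z * pos i q) ∂pos≡0 ⟩
    ∂ℓ i * v + 0ℚ * pos i q      ≡⟨ solve 3 (λ e v p → e :* v :+ con 0ℚ :* p := e :* v) refl (∂ℓ i) v (pos i q) ⟩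
    ∂ℓ i * v                     ≡⟨ ∂ℓv≡κ ⟩
    κ                            ∎
    where
    open ≡-Reasoning
    open +-*-Solver

  isLevel-value : ∀ i {v w} → IsLevel i v → IsLevel i w → v ≡ w
  isLevel-value i {v} {w} (∂pos≡0 , v≡) (_ , w≡) = p-q≡0⇒p≡q (p*q≡0⇒p≡0 (∂ℓ≢0 i ∂pos≡0) (begin
    (v - w) * ∂ℓ i        ≡⟨ solve 3 (λ e v w → (v :- w) :* e := e :* v :- e :* w) refl (∂ℓ i) v w ⟩
    ∂ℓ i * v - ∂ℓ i * w   ≡⟨ cong₂ _-_ v≡ w≡ ⟩
    κ - κ                 ≡⟨ ℚ.+-inverseʳ κ ⟩
    0ℚ                    ∎))
    where
    open ≡-Reasoning
    open +-*-Solver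
    ∂ℓ≢0 : ∀ i → ∂pos i ≡ 0ℚ → ∂ℓ i ≢ 0ℚ
    ∂ℓ≢0 zero             α≡0  β≡0 = nonzero (α≡0 , β≡0)
    ∂ℓ≢0 (suc zero)       -β≡0 α≡0 = nonzero (α≡0 , ℚ.neg-injective -β≡0)
    ∂ℓ≢0 (suc (suc zero)) β-α≡0 α≡0 = nonzero (α≡0 , trans (p-q≡0⇒p≡q β-α≡0) α≡0)

  -- Vanishing for two different directions would make `α` and `β` both zero.
  ∂pos-unique : ∀ i j → ∂pos i ≡ 0ℚ → ∂pos j ≡ 0ℚ → i ≡ j
  ∂pos-unique zero zero _ _ = refl
  ∂pos-unique (suc zero) (suc zero) _ _ = refl
  ∂pos-unique (suc (suc zero)) (suc (suc zero)) _ _ = refl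
  ∂pos-unique zero (suc zero) e e′ = ⊥-elim (nonzero (e , ℚ.neg-injective e′))
  ∂pos-unique (suc zero) zero e e′ = ⊥-elim (nonzero (e′ , ℚ.neg-injective e))
  ∂pos-unique zero (suc (suc zero)) e e′ = ⊥-elim (nonzero (e , trans (p-q≡0⇒p≡q e′) e))
  ∂pos-unique (suc (suc zero)) zero e e′ = ⊥-elim (nonzero (e′ , trans (p-q≡0⇒p≡q e) e′))
  ∂pos-unique (suc zero) (suc (suc zero)) e e′ =
    ⊥-elim (nonzero (trans (sym (p-q≡0⇒p≡q e′)) (ℚ.neg-injective e) , ℚ.neg-injective e))
  ∂pos-unique (suc (suc zero)) (suc zero) e e′ =
    ⊥-elim (nonzero (trans (sym (p-q≡0⇒p≡q e)) (ℚ.neg-injective e′) , ℚ.neg-injective e′))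

-- The cyclic order of the three directions, and cyclic descents

next prev : Fin 3 → Fin 3
next zero             = c₁
next (suc zero)       = s₂
next (suc (suc zero)) = r₀
prev zero             = s₂
prev (suc zero)       = r₀
prev (suc (suc zero)) = c₁

≢next : ∀ i → i ≢ next i
≢next zero             ()
≢next (suc zero)       ()
≢next (suc (suc zero)) ()

next-prev : ∀ i → next (prev i) ≡ i
next-prev zero             = refl
next-prev (suc zero)       = refl
next-prev (suc (suc zero)) = refl

dirs : List (Fin 3)
dirs = r₀ ∷ c₁ ∷ s₂ ∷ []

∈dirs : ∀ i → i ∈ dirs
∈dirs zero             = here refl
∈dirs (suc zero)       = there (here refl)
∈dirs (suc (suc zero)) = there (there (here refl))

module _ {A : Set} where

  when : Bool → A → List A
  when true  x = x ∷ []
  when false x = []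

  ∈when : ∀ {b x} → b ≡ true → x ∈ when b x
  ∈when refl = here refl

  module _ (u : Fin 3 → Bool) (e e′ : Fin 3 → A) where

    descentsAt boundaryAt : Fin 3 → List A
    descentsAt i = when (u i ∧ not (u (prev i))) (e i)
    boundaryAt i = when (u i) (e i) ++ when (not (u (prev i))) (e′ i)

    descents boundary : List A
    descents = concatMap descentsAt dirs
    boundary = concatMap boundaryAt dirs

    -- Two steps from false to true along the cycle must be separated by steps back, which takes
    -- four positions.
    length-descents : length descents ℕ.≤ 1
    length-descents with u r₀ | u c₁ | u s₂
    ... | true  | true  | true  = z≤n
    ... | true  | true  | false = s≤s z≤n
    ... | true  | false | true  = s≤s z≤n
    ... | true  | false | false = s≤s z≤n
    ... | false | true  | true  = s≤s z≤n
    ... | false | true  | false = s≤s z≤n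
    ... | false | false | true  = s≤s z≤n
    ... | false | false | false = z≤n

    -- Each index `k` contributes exactly once: at `k` if `u k` is true, at the successor of `k`
    -- otherwise.
    length-boundary : length boundary ≡ 3
    length-boundary with u r₀ | u c₁ | u s₂
    ... | true  | true  | true  = refl
    ... | true  | true  | false = refl
    ... | true  | false | true  = refl
    ... | true  | false | false = refl
    ... | false | true  | true  = refl
    ... | false | true  | false = refl
    ... | false | false | true  = refl
    ... | false | false | false = refl

    descent∈ : ∀ i → u i ≡ true → u (prev i) ≡ false → e i ∈ descents
    descent∈ i p q = ∈-concatMap⁺ descentsAt (lose (∈dirs i) (∈when (cong₂ (λ b c → b ∧ not c) p q)))

    tail∈boundary : ∀ i → u i ≡ true → e i ∈ boundary
    tail∈boundary i p = ∈-concatMap⁺ boundaryAt (lose (∈dirs i) (∈-++⁺ˡ (∈when p)))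

    head∈boundary : ∀ i → u (prev i) ≡ false → e′ i ∈ boundary
    head∈boundary i q = ∈-concatMap⁺ boundaryAt (lose (∈dirs i) (∈-++⁺ʳ (when (u i) (e i)) (∈when (cong not q))))

open import Data.List.Membership.DecPropositional _≟ᵗ_ using (_∈?_)

-- Contiguity of the sides on each line

module Contiguity {T* T△ : List Triple} (bitrade : IsBitrade T* T△) {a : Triple} (a∈T* : a ∈ T*)
                  (f : Assignment) (solves : SolvesEq T* a f) (separated : SeparatedSolution T* f)
                  (euler : m T* ≡ size T* ℕ.+ 2) where

  open IsBitrade bitrade
  open Solved bitrade a∈T* f solves separated

  -- Vertex `i` is where the lines of directions `i` and `next i` meet, so the side in direction `i`
  -- joins vertices `i` and `prev i`.
  tl hd : Fin 3 → Triple → ℚ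
  tl i c = pos i (vertex i c)
  hd i c = pos i (vertex (prev i) c)

  -- The difference is the same for all `i`, so the orientation of a triangle decides for its three
  -- sides at once which end is the left one.
  ends-width : ∀ i c → hd i c - tl i c ≡ width c
  ends-width zero c =
    solve 3 (λ r c s → (s :- r) :- c := s :- (r :+ c)) refl (val r₀ c) (val c₁ c) (val s₂ c)
    where open +-*-Solver
  ends-width (suc zero) c =
    solve 3 (λ r c s → (:- r) :- (:- (s :- c)) := s :- (r :+ c)) refl (val r₀ c) (val c₁ c) (val s₂ c)
    where open +-*-Solver
  ends-width (suc (suc zero)) c =
    solve 3 (λ r c s → (s :- c) :- r := s :- (r :+ c)) refl (val r₀ c) (val c₁ c) (val s₂ c)
    where open +-*-Solver

  tail-on : ∀ i c → ℓ i (vertex i c) ≡ val i c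
  tail-on zero             c = refl
  tail-on (suc zero)       c = refl
  tail-on (suc (suc zero)) c = solve 2 (λ r s → (s :- r) :+ r := s) refl (val r₀ c) (val s₂ c)
    where open +-*-Solver

  head-on : ∀ i c → ℓ i (vertex (prev i) c) ≡ val i c
  head-on zero             c = refl
  head-on (suc zero)       c = refl
  head-on (suc (suc zero)) c = solve 2 (λ c s → c :+ (s :- c) := s) refl (val c₁ c) (val s₂ c)
    where open +-*-Solver

  -- Only two coordinates enter a vertex, so partners in `T*` and `T△` share it.
  vertex-local : ∀ k {c d} → Agree k (next k) c d → vertex k c ≡ vertex k d
  vertex-local zero             (p , q) = cong₂ (λ k l → f c₁ l , f r₀ k) p q
  vertex-local (suc zero)       (p , q) = cong₂ (λ k l → f c₁ k , f s₂ l - f c₁ k) p q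
  vertex-local (suc (suc zero)) (p , q) = cong₂ (λ k l → f s₂ k - f r₀ l , f r₀ l) p q

  tl≢hd : ∀ i {c} → c ∈ T△ → tl i c ≢ hd i c
  tl≢hd i {c} c∈ eq = nondegenerate c∈ (sym (p-q≡0⇒p≡q
    (trans (sym (ends-width i c)) (p≡q⇒p-q≡0 (sym eq)))))

  -- The three lines are concurrent, so an element of `T*` other than `a` stands for a single point.
  tl≡hd : ∀ i {b} → b ∈ T* → b ≢ a → tl i b ≡ hd i b
  tl≡hd i {b} b∈ b≢a = sym (p-q≡0⇒p≡q (trans (ends-width i b) (p≡q⇒p-q≡0 (sym (equation b∈ b≢a)))))

  partner : ∀ k {b} → b ∈ T* → ∃[ c ] (c ∈ T△ × Agree k (next k) b c)
  partner k {b} b∈ = proj₁ (*→△ k (next k) (≢next k) b b∈)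

  partner* : ∀ k {c} → c ∈ T△ → ∃[ b ] (b ∈ T* × Agree k (next k) c b)
  partner* k {c} c∈ = proj₁ (△→* k (next k) (≢next k) c c∈)

  -- `ends` is mapped over a list and carries no membership proof, hence the dummy value `b` outside
  -- `T*`.
  tri : Fin 3 → Triple → Triple
  tri k b with b ∈? T*
  ... | yes b∈ = proj₁ (partner k b∈)
  ... | no _   = b

  tri-partner : ∀ k {b} → b ∈ T* → tri k b ∈ T△ × Agree k (next k) b (tri k b)
  tri-partner k {b} b∈ with b ∈? T*
  ... | yes b∈′ = proj₂ (partner k b∈′)
  ... | no b∉   = contradiction b∈ b∉

  tri-unique : ∀ k {b c} → b ∈ T* → c ∈ T△ → Agree k (next k) c b → tri k b ≡ c
  tri-unique k b∈ c∈ (p , q) = let t∈ , p′ , q′ = tri-partner k b∈ in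
    agree△⇒≡ k (next k) (≢next k) t∈ c∈ (sym (trans p p′) , sym (trans q q′))

  isUp : Triple → Bool
  isUp c = does (0ℚ ℚ.<? width c)

  tl<hd⇒isUp : ∀ i {c} → tl i c < hd i c → isUp c ≡ true
  tl<hd⇒isUp i {c} lt = dec-true (0ℚ ℚ.<? width c) (subst (0ℚ <_) (ends-width i c) (p<q⇒0<q-p lt))

  hd≤tl⇒¬isUp : ∀ i {c} → hd i c ≤ tl i c → isUp c ≡ false
  hd≤tl⇒¬isUp i {c} le = dec-false (0ℚ ℚ.<? width c) (≤⇒≯ (subst (_≤ 0ℚ) (ends-width i c) (q≤p⇒q-p≤0 le)))

  Label End : Set
  Label = Fin 3 × ℕ
  End   = Label × ℚ

  tailEnd headEnd : Triple → Fin 3 → End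
  tailEnd b i = (i , coord i b) , tl i b
  headEnd b i = (i , coord i b) , hd i b

  up : Triple → Fin 3 → Bool
  up b k = isUp (tri k b)

  -- Where the sides on some line have a left end at b.  Only two of the three triangles at b ≢ a
  -- have a side on a given line, and they both extend to the right exactly at a cyclic descent of
  -- their orientations; at a, which stands for the three corners of Σ, each triangle is on its own.
  ends : Triple → List End
  ends b with b ≟ᵗ a
  ... | yes _ = boundary (up b) (tailEnd b) (headEnd b)
  ... | no _  = descents (up b) (tailEnd b) (headEnd b)

  length-ends : ∀ {b} → b ≢ a → length (ends b) ℕ.≤ 1
  length-ends {b} b≢a with b ≟ᵗ a
  ... | yes b≡a = contradiction b≡a b≢a
  ... | no _    = length-descents (up b) (tailEnd b) (headEnd b)

  length-ends-a : length (ends a) ≡ 3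
  length-ends-a with a ≟ᵗ a
  ... | yes _  = length-boundary (up a) (tailEnd a) (headEnd a)
  ... | no a≢a = contradiction refl a≢a

  tailEnd∈ : ∀ i b → up b i ≡ true → (b ≢ a → up b (prev i) ≡ false) → tailEnd b i ∈ ends b
  tailEnd∈ i b p q with b ≟ᵗ a
  ... | yes _  = tail∈boundary (up b) (tailEnd b) (headEnd b) i p
  ... | no b≢a = descent∈ (up b) (tailEnd b) (headEnd b) i p (q b≢a)

  headEnd∈ : ∀ i {b} → b ∈ T* → up b (prev i) ≡ false → (b ≢ a → up b i ≡ true) → headEnd b i ∈ ends b
  headEnd∈ i {b} b∈ q p with b ≟ᵗ a
  ... | yes _  = head∈boundary (up b) (tailEnd b) (headEnd b) i q
  -- A descent records the tail; away from `a` the head of `b` is at the same position.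
  ... | no b≢a = subst (λ z → ((i , coord i b) , z) ∈ descents (up b) (tailEnd b) (headEnd b)) (tl≡hd i b∈ b≢a)
                   (descent∈ (up b) (tailEnd b) (headEnd b) i (p b≢a) q)

  allEnds : List End
  allEnds = concatMap ends T*

  ∈allEnds : ∀ {b e} → b ∈ T* → e ∈ ends b → e ∈ allEnds
  ∈allEnds b∈ e∈ = ∈-concatMap⁺ ends (lose b∈ e∈)

  -- At most one end for each triple but `a` and three for `a` give the size plus 2, which is `m T*`
  -- by `euler`. The extra 1 on both sides is the `k` of `sum≤-except`.
  length-allEnds : length allEnds ℕ.≤ m T*
  length-allEnds = ℕ.+-cancelʳ-≤ 1 _ _ (begin
    length allEnds ℕ.+ 1                  ≡⟨ cong (ℕ._+ 1) (length-concatMap ends T*) ⟩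
    sum (map (length ∘ ends) T*) ℕ.+ 1    ≤⟨ sum≤-except (length ∘ ends) 1 uniq* a∈T* (λ _ → length-ends) ⟩
    length (ends a) ℕ.+ length T* ℕ.* 1   ≡⟨ cong₂ ℕ._+_ length-ends-a (ℕ.*-identityʳ (length T*)) ⟩
    3 ℕ.+ length T*                       ≡⟨ ℕ-solve 1 (λ n → ℕ-con 3 ∔ n ≐ (n ∔ ℕ-con 2) ∔ ℕ-con 1) refl (length T*) ⟩
    length T* ℕ.+ 2 ℕ.+ 1                 ≡⟨ cong (ℕ._+ 1) euler ⟨
    m T* ℕ.+ 1                            ∎)
    where
    open ℕ.≤-Reasoning
    open ℕ-Solver using () renaming (solve to ℕ-solve; _:+_ to _∔_; _:=_ to _≐_; con to ℕ-con)

  coord-next-prev : ∀ i {c d} → Agree (prev i) (next (prev i)) c d → coord i c ≡ coord i d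
  coord-next-prev i {c} {d} (_ , q) = subst (λ j → coord j c ≡ coord j d) (next-prev i) q

  -- `Q` selects whole sides on the line with label `n`, so it must not separate the two ends of
  -- one. It is trivial for the leftmost point of the line, and `t <_` for the leftmost point beyond
  -- a gap at `t`.
  module LeftEnd (i : Fin 3) (n : ℕ) (Q : ℚ → Set) (Q? : ∀ p → Dec (Q p))
                 (tl⇒hd : ∀ {c} → c ∈ T△ → coord i c ≡ n → Q (tl i c) → Q (hd i c))
                 (hd⇒tl : ∀ {c} → c ∈ T△ → coord i c ≡ n → Q (hd i c) → Q (tl i c)) where

    low : Triple → ℚ
    low c = tl i c ℚ.⊓ hd i c

    Candidate : Triple → Set
    Candidate c = coord i c ≡ n × Q (tl i c)

    candidates : List Triple
    candidates = filter (λ c → coord i c ℕ.≟ n ×-dec Q? (tl i c)) T△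

    Lowest : ℚ → Set
    Lowest p = ∀ {d} → d ∈ T△ → Candidate d → p ≤ tl i d × p ≤ hd i d

    LeftEndAt : ℚ → Set
    LeftEndAt p = ((i , n) , p) ∈ allEnds × Q p × Lowest p

    -- `c` points up and starts at the lowest position. When `b` is not `a`, the other triangle on
    -- the line at that vertex, `tri (prev i) b`, has its head there; pointing up it would start
    -- still lower. So it points down, and `b` has a left end.
    tail-lowest : ∀ {c} → c ∈ T△ → Candidate c → tl i c < hd i c → Lowest (tl i c) → LeftEndAt (tl i c)
    tail-lowest {c} c∈ (c≡n , Qc) lt lowest with b , b∈ , ag ← partner* i c∈ =
      subst₂ (λ k p → ((i , k) , p) ∈ allEnds) (trans (sym (proj₁ ag)) c≡n) tl≡
        (∈allEnds b∈ (tailEnd∈ i b isTail isHead)) , Qc , lowest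
      where
      tl≡ : tl i b ≡ tl i c
      tl≡ = cong (pos i) (sym (vertex-local i ag))
      isTail : up b i ≡ true
      isTail = trans (cong isUp (tri-unique i b∈ c∈ ag)) (tl<hd⇒isUp i lt)
      isHead : b ≢ a → up b (prev i) ≡ false
      isHead b≢a =
        let d∈ , ag′ = tri-partner (prev i) b∈
            d≡n = trans (sym (coord-next-prev i ag′)) (trans (sym (proj₁ ag)) c≡n)
            hd≡ = trans (cong (pos i) (sym (vertex-local (prev i) ag′))) (trans (sym (tl≡hd i b∈ b≢a)) tl≡)
            Qd  = hd⇒tl d∈ d≡n (subst Q (sym hd≡) Qc)
        in hd≤tl⇒¬isUp i (subst (_≤ tl i (tri (prev i) b)) (sym hd≡) (proj₁ (lowest d∈ (d≡n , Qd))))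

    -- Mirror image: `c` points down, so its head is lowest, and away from `a` the other triangle
    -- `tri i b` must point up.
    head-lowest : ∀ {c} → c ∈ T△ → Candidate c → hd i c ≤ tl i c → Lowest (hd i c) → LeftEndAt (hd i c)
    head-lowest {c} c∈ (c≡n , Qc) le lowest with b , b∈ , ag ← partner* (prev i) c∈ =
      subst₂ (λ k p → ((i , k) , p) ∈ allEnds) (trans (sym (coord-next-prev i ag)) c≡n) hd≡
        (∈allEnds b∈ (headEnd∈ i b∈ isHead isTail)) , Qhd , lowest
      where
      Qhd : Q (hd i c)
      Qhd = tl⇒hd c∈ c≡n Qc
      hd≡ : hd i b ≡ hd i c
      hd≡ = cong (pos i) (sym (vertex-local (prev i) ag))
      isHead : up b (prev i) ≡ false
      isHead = trans (cong isUp (tri-unique (prev i) b∈ c∈ ag)) (hd≤tl⇒¬isUp i le)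
      isTail : b ≢ a → up b i ≡ true
      isTail b≢a =
        let d∈ , ag′ = tri-partner i b∈
            d≡n = trans (sym (proj₁ ag′)) (trans (sym (coord-next-prev i ag)) c≡n)
            tl≡ = trans (cong (pos i) (sym (vertex-local i ag′))) (trans (tl≡hd i b∈ b≢a) hd≡)
            Qd  = subst Q (sym tl≡) Qhd
        in tl<hd⇒isUp i (≤∧≢⇒< (subst (_≤ hd i (tri i b)) (sym tl≡) (proj₂ (lowest d∈ (d≡n , Qd)))) (tl≢hd i d∈))

    leftEnd : ∀ {c₀} → c₀ ∈ T△ → Candidate c₀ → ∃[ p ] LeftEndAt p
    leftEnd {c₀} c₀∈ cand₀ = go (tl i c ℚ.<? hd i c)
      where
      c : Triple
      -- The default `c₀` of `argmin` is itself a candidate.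
      c = argmin low c₀ candidates
      c-candidate : c ∈ T△ × Candidate c
      c-candidate = argmin-all low {P = λ d → d ∈ T△ × Candidate d} (c₀∈ , cand₀) (All.tabulate (∈-filter⁻ _))
      lowest : ∀ {p} → low c ≡ p → Lowest p
      lowest refl {d} d∈ cand =
        let le = All.lookup (f[argmin]≤f[xs] {f = low} c₀ candidates) (∈-filter⁺ _ d∈ cand) in
        ℚ.≤-trans le (ℚ.p⊓q≤p (tl i d) (hd i d)) , ℚ.≤-trans le (ℚ.p⊓q≤q (tl i d) (hd i d))
      go : Dec (tl i c < hd i c) → ∃[ p ] LeftEndAt p
      go (yes lt) = tl i c , tail-lowest (proj₁ c-candidate) (proj₂ c-candidate) lt
                                (lowest (ℚ.p≤q⇒p⊓q≡p (ℚ.<⇒≤ lt)))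
      go (no ≮)   = hd i c , head-lowest (proj₁ c-candidate) (proj₂ c-candidate) (ℚ.≮⇒≥ ≮)
                                (lowest (ℚ.p≥q⇒p⊓q≡q (ℚ.≮⇒≥ ≮)))

  module Everywhere i n = LeftEnd i n (λ _ → ⊤) (λ _ → yes tt) (λ _ _ _ → tt) (λ _ _ _ → tt)

  labels : Fin 3 → List Label
  labels i = map (i ,_) (deduplicate ℕ._≟_ (map (coord i) T*))

  -- The partner of any triple bearing the label supplies a triangle on its line, hence a left end.
  -- The first component serves to show the three lists of labels disjoint.
  ∈labels⇒ : ∀ i {l} → l ∈ labels i → proj₁ l ≡ i × l ∈ map proj₁ allEnds
  ∈labels⇒ i l∈ with n , n∈ , refl ← ∈-map⁻ (i ,_) l∈
                with b , b∈ , refl ← ∈-map⁻ (coord i) (∈-deduplicate⁻ ℕ._≟_ _ n∈) =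
    let d∈ , ag = tri-partner i b∈
        p , p∈ , _ = Everywhere.leftEnd i (coord i b) d∈ (sym (proj₁ ag) , tt)
    in refl , ∈-map⁺ proj₁ p∈

  allLabels : List Label
  allLabels = (labels r₀ ++ labels c₁) ++ labels s₂

  allLabels⊆ : ∀ {l} → l ∈ allLabels → l ∈ map proj₁ allEnds
  allLabels⊆ l∈ with ∈-++⁻ (labels r₀ ++ labels c₁) l∈
  ... | inj₂ l∈₂ = proj₂ (∈labels⇒ s₂ l∈₂)
  ... | inj₁ l∈₀₁ with ∈-++⁻ (labels r₀) l∈₀₁
  ...   | inj₁ l∈₀ = proj₂ (∈labels⇒ r₀ l∈₀)
  ...   | inj₂ l∈₁ = proj₂ (∈labels⇒ c₁ l∈₁)

  unique-labels : ∀ i → Unique (labels i)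
  unique-labels i = Unique.map⁺ (cong proj₂) (deduplicate-! (map (coord i) T*))

  unique-allLabels : Unique allLabels
  unique-allLabels = Unique.++⁺
    (Unique.++⁺ (unique-labels r₀) (unique-labels c₁)
      λ (p , q) → r₀≢c₁ (trans (sym (proj₁ (∈labels⇒ r₀ p))) (proj₁ (∈labels⇒ c₁ q))))
    (unique-labels s₂)
    λ (p , q) → [ (λ p₀ → r₀≢s₂ (trans (sym (proj₁ (∈labels⇒ r₀ p₀))) (proj₁ (∈labels⇒ s₂ q))))
                , (λ p₁ → c₁≢s₂ (trans (sym (proj₁ (∈labels⇒ c₁ p₁))) (proj₁ (∈labels⇒ s₂ q)))) ]′
                (∈-++⁻ (labels r₀) p)

  length-labels : ∀ i → length (labels i) ≡ o i T*
  length-labels i = length-map (i ,_) (deduplicate ℕ._≟_ (map (coord i) T*))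

  length-allLabels : length allLabels ≡ m T*
  length-allLabels = trans (length-++ (labels r₀ ++ labels c₁)) (cong₂ ℕ._+_
    (trans (length-++ (labels r₀)) (cong₂ ℕ._+_ (length-labels r₀) (length-labels c₁))) (length-labels s₂))

  -- There are at most m left ends, and every label has one.
  leftEnd-unique : ∀ {l p q} → (l , p) ∈ allEnds → (l , q) ∈ allEnds → p ≡ q
  leftEnd-unique p∈ q∈ = cong proj₂ (surjective⇒injective proj₁ unique-allLabels allLabels⊆
    (subst (length allEnds ℕ.≤_) (sym length-allLabels) length-allEnds) p∈ q∈ refl)

  module Gap (i : Fin 3) (n : ℕ) (t : ℚ)
             (gap : ∀ {c} → c ∈ T△ → coord i c ≡ n → ¬ Between (tl i c) (hd i c) t) where

    -- A side with its ends on different sides of `t` would cover `t`, so `t <_` is a legitimate `Q`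
    -- for `LeftEnd`.
    tl⇒hd : ∀ {c} → c ∈ T△ → coord i c ≡ n → t < tl i c → t < hd i c
    tl⇒hd c∈ c≡n lt = ℚ.≰⇒> λ hd≤t → gap c∈ c≡n (inj₂ (hd≤t , ℚ.<⇒≤ lt))

    hd⇒tl : ∀ {c} → c ∈ T△ → coord i c ≡ n → t < hd i c → t < tl i c
    hd⇒tl c∈ c≡n lt = ℚ.≰⇒> λ tl≤t → gap c∈ c≡n (inj₁ (tl≤t , ℚ.<⇒≤ lt))

    -- The leftmost of the sides beyond the gap provides a left end greater than `t`, and the
    -- leftmost of all sides provides another; the two coincide by `leftEnd-unique`.
    all-right : ∀ {c d} → c ∈ T△ → coord i c ≡ n → d ∈ T△ → coord i d ≡ n → t < tl i d → t < tl i c × t < hd i c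
    all-right c∈ c≡n d∈ d≡n t<d =
      let p , p∈ , t<p , _ = LeftEnd.leftEnd i n (t <_) (t ℚ.<?_) tl⇒hd hd⇒tl d∈ (d≡n , t<d)
          q , q∈ , _ , lowest = Everywhere.leftEnd i n c∈ (c≡n , tt)
          t<q = subst (t <_) (leftEnd-unique p∈ q∈) t<p
          q≤tl , q≤hd = lowest c∈ (c≡n , tt)
      in ℚ.<-≤-trans t<q q≤tl , ℚ.<-≤-trans t<q q≤hd

    -- If `d` has its tail beyond `t`, all sides are beyond it, against `p ≤ t`. Otherwise the whole
    -- side of `d` lies at or before `t`, so `q` equals `t` and `t` is covered after all.
    no-gap : ∀ {c d p q} → c ∈ T△ → coord i c ≡ n → d ∈ T△ → coord i d ≡ n →
             Between (tl i c) (hd i c) p → Between (tl i d) (hd i d) q → p ≤ t → t ≤ q → ⊥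
    no-gap {c} {d} {p} {q} c∈ c≡n d∈ d≡n p-on q-on p≤t t≤q with t ℚ.<? tl i d
    ... | yes t<d = let t<tl , t<hd = all-right c∈ c≡n d∈ d≡n t<d in <⇒≱ (between-> t<tl t<hd p-on) p≤t
    ... | no t≮tl = gap d∈ d≡n (subst (Between (tl i d) (hd i d)) (ℚ.≤-antisym
      (between-≤ (ℚ.≮⇒≥ t≮tl) (ℚ.≮⇒≥ (t≮tl ∘ hd⇒tl d∈ d≡n)) q-on) t≤q) q-on)

  covered-between : ∀ i n {c d p q t} → c ∈ T△ → coord i c ≡ n → d ∈ T△ → coord i d ≡ n →
                    Between (tl i c) (hd i c) p → Between (tl i d) (hd i d) q → Between p q t →
                    ∃[ e ] (e ∈ T△ × coord i e ≡ n × Between (tl i e) (hd i e) t)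
  covered-between i n {t = t} c∈ c≡n d∈ d≡n p-on q-on btw
    with any? (λ e → coord i e ℕ.≟ n ×-dec between? (tl i e) (hd i e) t) T△
  ... | yes found = find found
  ... | no none   = ⊥-elim ([ (λ (p≤t , t≤q) → no-gap c∈ c≡n d∈ d≡n p-on q-on p≤t t≤q)
                            , (λ (q≤t , t≤p) → no-gap d∈ d≡n c∈ c≡n q-on p-on q≤t t≤p) ]′ btw)
    where open Gap i n t (λ e∈ e≡n on → none (lose e∈ (e≡n , on)))

  -- Sides contained in a given line

  OnSide : Line → Fin 3 → Triple → Point → Set
  OnSide L i c q = IsLevel L i (val i c) × ℓ i q ≡ val i c × Between (tl i c) (hd i c) (pos i q)

  segment⇒onSide : ∀ L i {v u w q} → ℓ i u ≡ v → ℓ i w ≡ v → pos i u ≢ pos i w →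
                   (∀ r → OnSegment u w r → OnLine L r) → OnSegment u w q →
                   IsLevel L i (v) × ℓ i q ≡ v × Between (pos i u) (pos i w) (pos i q)
  segment⇒onSide L i {u = u} {w} ℓu ℓw u≢w on seg =
    onLine⇒isLevel L i ℓu ℓw u≢w (on u (start∈segment u w)) (on w (end∈segment u w)) , segment⇒ i ℓu ℓw seg

  onSide⇒segment : ∀ L i {v u w q} → ℓ i u ≡ v → ℓ i w ≡ v → pos i u ≢ pos i w →
                   IsLevel L i (v) → ℓ i q ≡ v → Between (pos i u) (pos i w) (pos i q) →
                   (∀ r → OnSegment u w r → OnLine L r) × OnSegment u w q
  onSide⇒segment L i ℓu ℓw u≢w lev ℓq btw =
    (λ r seg → isLevel⇒onLine L i lev (proj₁ (segment⇒ i ℓu ℓw seg))) , ⇒segment i ℓu ℓw u≢w ℓq btw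

  sidesOn⇒ : ∀ L {c q} → c ∈ T△ → OnSideContainedIn f c (OnLine L) q → ∃[ i ] OnSide L i c q
  sidesOn⇒ L {c} c∈ (inj₁ (on , seg)) =
    -- `OnSideContainedIn` lists the column and symbol sides from head to tail and the row side from
    -- tail to head, hence the swaps for the first two.
    let lev , ℓq , btw = segment⇒onSide L c₁ (head-on c₁ c) (tail-on c₁ c) (tl≢hd c₁ c∈ ∘ sym) on seg in
    c₁ , lev , ℓq , swap btw
  sidesOn⇒ L {c} c∈ (inj₂ (inj₁ (on , seg))) =
    let lev , ℓq , btw = segment⇒onSide L s₂ (head-on s₂ c) (tail-on s₂ c) (tl≢hd s₂ c∈ ∘ sym) on seg in
    s₂ , lev , ℓq , swap btw
  sidesOn⇒ L {c} c∈ (inj₂ (inj₂ (on , seg))) =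
    r₀ , segment⇒onSide L r₀ (tail-on r₀ c) (head-on r₀ c) (tl≢hd r₀ c∈) on seg

  ⇒sidesOn : ∀ L i {c q} → c ∈ T△ → OnSide L i c q → OnSideContainedIn f c (OnLine L) q
  ⇒sidesOn L zero {c} c∈ (lev , ℓq , btw) =
    inj₂ (inj₂ (onSide⇒segment L r₀ (tail-on r₀ c) (head-on r₀ c) (tl≢hd r₀ c∈) lev ℓq btw))
  ⇒sidesOn L (suc zero) {c} c∈ (lev , ℓq , btw) =
    inj₁ (onSide⇒segment L c₁ (head-on c₁ c) (tail-on c₁ c) (tl≢hd c₁ c∈ ∘ sym) lev ℓq (swap btw))
  ⇒sidesOn L (suc (suc zero)) {c} c∈ (lev , ℓq , btw) =
    inj₂ (inj₁ (onSide⇒segment L s₂ (head-on s₂ c) (tail-on s₂ c) (tl≢hd s₂ c∈ ∘ sym) lev ℓq (swap btw)))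

  -- Equal levels mean equal labels by separation, so both sides belong to one label and
  -- `covered-between` applies.
  contiguous-level : ∀ L i {c₁ c₂ q₁ q₂ q} → c₁ ∈ T△ → c₂ ∈ T△ → OnSide L i c₁ q₁ → OnSide L i c₂ q₂ →
                     OnSegment q₁ q₂ q → SidesOn T△ f L q
  contiguous-level L i {c} {d} {q₁} {q₂} c∈ d∈ (lev , ℓq₁ , on₁) (lev′ , ℓq₂ , on₂) seg =
    let val≡ = isLevel-value L i lev′ lev
        ℓq , btw = segment⇒ i ℓq₁ (trans ℓq₂ val≡) seg
        e , e∈ , e≡ , on = covered-between i (coord i c) c∈ refl d∈ (separated△ i d∈ c∈ val≡) on₁ on₂ btw
        val-e = cong (f i) (sym e≡)
    in e , e∈ , ⇒sidesOn L i e∈ (subst (IsLevel L i) val-e lev , trans ℓq val-e , on)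

  contiguous : ContiguousSides T△ f
  contiguous L q₁ q₂ (c , c∈ , side₁) (d , d∈ , side₂) q seg =
    let i , on₁ = sidesOn⇒ L c∈ side₁
        j , on₂ = sidesOn⇒ L d∈ side₂
        j≡i = ∂pos-unique L j i (proj₁ (proj₁ on₂)) (proj₁ (proj₁ on₁))
    in contiguous-level L i c∈ d∈ on₁ (subst (λ k → OnSide L k d q₂) j≡i on₂) seg

theorem2p1 : (T* T△ : List Triple) → IsSpherical T* T△ →
    (a : Triple) → a ∈ T* →
    (f : Assignment) → SolvesEq T* a f → SeparatedSolution T* f →
    ((c : Triple) → c ∈ T△ → ¬ Degenerate f c)
    × CoversΣ T△ f
    × InteriorsDisjoint T△ f
    × SeparatedDissection T△ f
theorem2p1 T* T△ (bitrade , _ , euler) a a∈T* f solves separated =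
  ¬degenerate , covers , disjoint , no-sixfold-vertex , contiguous
  where
  open Solved bitrade a∈T* f solves separated
  open Contiguity bitrade a∈T* f solves separated euler
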